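{- Let $T$ be a tree on $n\geq 6$ vertices such that $p(T)=q(T)$ and $T$ contains no pendant path $P_3$. Then $$m_{L(T)}(1)\leq \frac{n-6}{4},$$ and equality holds if and only if $T$ is isomorphic to the following tree $T_k$ for some integer $k\geq 0$ (so $n=4k+6$): take vertices $c_0,c_1,\dots,c_k$; attach one pendant vertex to each $c_i$; for each $0\le i\le k-1$ join $c_i$ and $c_{i+1}$ by a path $c_i a_i b_i c_{i+1}$ with two new internal vertices $a_i,b_i$ of degree $2$; finally attach to $c_0$ a pendant path $c_0 x_1 x_2$ and to $c_k$ a pendant path $c_k y_1 y_2$ (new vertices $x_1,x_2,y_1,y_2$, with $x_2,y_2$ pendant). (For $k=0$, $T_0$ is the tree on $6$ vertices consisting of a vertex $c_0$ with one pendant neighbor and two pendant paths of length $2$.)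
   Context: All graphs are finite, simple and undirected. $L(G)=D(G)-A(G)$ is the Laplacian matrix, and $m_{L(G)}(1)$ is the multiplicity of $1$ as an eigenvalue of $L(G)$. A pendant vertex has degree $1$; a quasi-pendant vertex is adjacent to a pendant vertex; $p(G)$, $q(G)$ are the numbers of pendant and quasi-pendant vertices. A pendant path $P_k$ of $G$ means that $G$ is obtained from a graph $G_1$ and a path $P_k$ by joining one end vertex of $P_k$ to a vertex of $G_1$ by an edge. -}

module Defs where

open import Data.Nat using (ℕ; zero; suc; _+_; _*_; _≡ᵇ_; _<ᵇ_; _≤ᵇ_)
open import Data.Fin using (Fin; toℕ) renaming (zero to fzero; suc to fsuc)
open import Data.Fin.Properties using (_≟_)
open import Data.Bool using (Bool; true; false; _∧_; _∨_; not; if_then_else_)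
open import Data.Vec using (Vec; lookup)
open import Data.Product using (Σ; _×_; ∃)
open import Data.Integer using (+_)
open import Data.Rational using (ℚ; 0ℚ; 1ℚ; -_; _-_) renaming (_+_ to _+ℚ_; _*_ to _*ℚ_)
open import Relation.Nullary using (¬_; does)
open import Relation.Binary.PropositionalEquality using (_≡_; _≢_)
open import Function.Bundles using (_↔_; Inverse)

record Graph (n : ℕ) : Set where
  field
    adj    : Fin n → Fin n → Bool
    adj-sym    : ∀ i j → adj i j ≡ adj j i
    adj-irrefl : ∀ i → adj i i ≡ false
open Graph public

countF : {n : ℕ} → (Fin n → Bool) → ℕ
countF {zero}  f = 0
countF {suc n} f = (if f fzero then 1 else 0) + countF (λ i → f (fsuc i))

anyF : {n : ℕ} → (Fin n → Bool) → Bool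
anyF {zero}  f = false
anyF {suc n} f = f fzero ∨ anyF (λ i → f (fsuc i))

sumℚ : {n : ℕ} → (Fin n → ℚ) → ℚ
sumℚ {zero}  f = 0ℚ
sumℚ {suc n} f = f fzero +ℚ sumℚ (λ i → f (fsuc i))

module _ {n : ℕ} (G : Graph n) where

  deg : Fin n → ℕ
  deg i = countF (adj G i)

  isPendant : Fin n → Bool
  isPendant i = deg i ≡ᵇ 1

  isQuasiPendant : Fin n → Bool
  isQuasiPendant i = anyF (λ j → adj G i j ∧ isPendant j)

  p : ℕ
  p = countF isPendant

  q : ℕ
  q = countF isQuasiPendant

  data Walk : Fin n → Fin n → Set where
    here : ∀ {i} → Walk i i
    step : ∀ {i j k} → adj G i j ≡ true → Walk j k → Walk i k

  Connected : Set
  Connected = ∀ i j → Walk i j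

  record Cycle : Set where
    field
      len      : ℕ
      vs       : Vec (Fin n) (suc (suc (suc len)))
      distinct : ∀ a b → lookup vs a ≡ lookup vs b → a ≡ b
      consec   : ∀ (a : Fin (suc (suc len))) →
                   adj G (lookup vs (Data.Fin.inject₁ a)) (lookup vs (fsuc a)) ≡ true
      closing  : adj G (lookup vs (Data.Fin.fromℕ (suc (suc len)))) (lookup vs fzero) ≡ true

  Acyclic : Set
  Acyclic = ¬ Cycle

  IsTree : Set
  IsTree = Connected × Acyclic

  -- G has a pendant path P₃: G is obtained from a graph G₁ and a path
  -- u₁ u₂ u₃ by joining u₁ to a vertex w of G₁ by an edge.
  HasPendantP3 : Set
  HasPendantP3 = Σ (Fin n) λ u₁ → Σ (Fin n) λ u₂ → Σ (Fin n) λ u₃ → Σ (Fin n) λ w →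
    (adj G w u₁ ≡ true) × (adj G u₁ u₂ ≡ true) × (adj G u₂ u₃ ≡ true) ×
    (deg u₁ ≡ 2) × (deg u₂ ≡ 2) × (deg u₃ ≡ 1)

  laplacian : Fin n → Fin n → ℚ
  laplacian i j =
    if does (i ≟ j) then Data.Rational._/_ (+ deg i) 1
    else (if adj G i j then - 1ℚ else 0ℚ)

  InEigenspace : ℚ → (Fin n → ℚ) → Set
  InEigenspace μ v = ∀ i → sumℚ (λ j → laplacian i j *ℚ v j) ≡ μ *ℚ v i

LinIndep : {n r : ℕ} → (Fin r → Fin n → ℚ) → Set
LinIndep {n} {r} vs = ∀ (c : Fin r → ℚ) →
  (∀ j → sumℚ (λ s → c s *ℚ vs s j) ≡ 0ℚ) → ∀ s → c s ≡ 0ℚ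

-- "m_{L(G)}(μ) ≥ r": the μ-eigenspace of L(G) contains r linearly
-- independent vectors.  m_{L(G)}(μ) is the largest such r.
MultAtLeast : {n : ℕ} → Graph n → ℚ → ℕ → Set
MultAtLeast {n} G μ r = Σ (Fin r → Fin n → ℚ) λ vs →
  LinIndep vs × (∀ s → InEigenspace G μ (vs s))

_≅_ : {n m : ℕ} → Graph n → Graph m → Set
_≅_ {n} {m} G H = Σ (Fin n ↔ Fin m) λ σ →
  ∀ i j → adj H (Inverse.to σ i) (Inverse.to σ j) ≡ adj G i j

-- The extremal trees T_k on 4k+6 vertices.
-- Labelling: c_i = i (0 ≤ i ≤ k); pendant neighbour of c_i = k+1+i;
-- a_i = 2k+2+i, b_i = 3k+2+i (0 ≤ i < k);
-- x₁ = 4k+2, x₂ = 4k+3, y₁ = 4k+4, y₂ = 4k+5.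

infix 5 _==_
_==_ : ℕ → ℕ → Bool
a == b = a ≡ᵇ b

-- directed edge relation (u the smaller endpoint)
edgeT : ℕ → ℕ → ℕ → Bool
edgeT k u v =
     ((u ≤ᵇ k) ∧ (v == u + k + 1))                                  -- c_i — pendant
  ∨ ((u <ᵇ k) ∧ (v == u + 2 * k + 2))                               -- c_i — a_i
  ∨ (((2 * k + 2) ≤ᵇ u) ∧ (u <ᵇ (3 * k + 2)) ∧ (v == u + k))        -- a_i — b_i
  ∨ ((1 ≤ᵇ u) ∧ (u ≤ᵇ k) ∧ (v == u + 3 * k + 1))                    -- b_i — c_{i+1}
  ∨ ((u == 0) ∧ (v == 4 * k + 2))                                   -- c₀ — x₁
  ∨ ((u == 4 * k + 2) ∧ (v == 4 * k + 3))                           -- x₁ — x₂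
  ∨ ((u == k) ∧ (v == 4 * k + 4))                                   -- c_k — y₁
  ∨ ((u == 4 * k + 4) ∧ (v == 4 * k + 5))                           -- y₁ — y₂

-- (the guard "i ≠ j" is redundant — edgeT never relates u to itself —
-- and is only there to make irreflexivity immediate)
adjT : (k : ℕ) → Fin (4 * k + 6) → Fin (4 * k + 6) → Bool
adjT k i j = (edgeT k (toℕ i) (toℕ j) ∨ edgeT k (toℕ j) (toℕ i)) ∧ not (does (i ≟ j))


Tk : (k : ℕ) → Graph (4 * k + 6)
Tk k = record { adj = adjT k ; adj-sym = symT ; adj-irrefl = irreflT }
  where
  open import Data.Bool.Properties using (∨-comm; ∧-zeroʳ)
  open import Data.Empty using (⊥-elim)
  open import Relation.Nullary using (yes; no)
  open import Relation.Binary.PropositionalEquality using (refl; cong₂; sym)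
  symT : ∀ i j → adjT k i j ≡ adjT k j i
  symT i j with i ≟ j | j ≟ i
  ... | yes p | yes _ = cong₂ _∧_ (∨-comm (edgeT k (toℕ i) (toℕ j)) (edgeT k (toℕ j) (toℕ i))) refl
  ... | yes p | no ¬q = ⊥-elim (¬q (sym p))
  ... | no ¬p | yes q = ⊥-elim (¬p (sym q))
  ... | no _  | no _  = cong₂ _∧_ (∨-comm (edgeT k (toℕ i) (toℕ j)) (edgeT k (toℕ j) (toℕ i))) refl
  irreflT : ∀ i → adjT k i i ≡ false
  irreflT i with i ≟ i
  ... | yes _ = ∧-zeroʳ _
  ... | no ¬p = ⊥-elim (¬p refl)

{-# OPTIONS --safe #-}
module Submission where

-- Call a vertex inner if it is neither pendant nor quasi-pendant. The equation at a pendant vertex forces an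
-- eigenvector for 1 to vanish on the quasi-pendant vertices, and since each of these has a single pendant
-- neighbour (p = q), the eigenvector is determined by its inner values and n = 2q + |inner|. Two
-- determining sets of coordinates bound the multiplicity m. The inner vertices of one colour of a 2-colouring
-- of the tree determine the rest, so 2m ≤ |inner|. Rooting the tree at a quasi-pendant vertex at the end of
-- the tree, an inner vertex is determined from below unless all its children are quasi-pendant; one
-- coordinate per quasi-pendant child suffices, and because there is no pendant P₃ three quasi-pendant
-- vertices (the root, a deepest one and one near the root) are not needed, so m ≤ q - 3. Together
-- 4m + 6 ≤ n. If equality holds, both bounds are attained: the first makes the inner vertices into adjacent
-- pairs of degree 2, and the second leaves only two edges between quasi-pendant vertices, one at the root
-- and one at the deepest leaf. Hence the non-pendant vertices form a single path on which the classes read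
-- Q Q (I I Q)^k Q, which is the tree T_k.

open import Defs
open import Data.Nat using (ℕ; _+_; _*_; _≤_)
open import Data.Rational using (1ℚ)
open import Data.Product using (Σ; _×_)
open import Function.Bundles using (_⇔_)
open import Relation.Nullary using (¬_)
open import Relation.Binary.PropositionalEquality using (_≡_)

open import Algebra.Bundles using (CommutativeRing)
open import Data.Bool using (Bool; true; false; _∧_; _∨_; not; if_then_else_; T)
import Data.Bool.Properties as Boolₚ
open import Data.Empty using (⊥; ⊥-elim)
open import Data.Fin using (Fin; toℕ; punchIn; punchOut; inject₁; fromℕ; fromℕ<) renaming (zero to fzero; suc to fsuc)
open import Data.Fin.Patterns using (0F; 1F; 2F; 3F; 4F; 5F; 6F; 7F)
open import Data.Fin.Permutation using (↔⇒≡)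
open import Data.Fin.Properties using (_≟_; suc-injective; any?; punchInᵢ≢i; punchOut-punchIn; toℕ-injective; toℕ<n; toℕ-fromℕ; toℕ-fromℕ<; toℕ-inject₁)
import Data.Integer as ℤ
import Data.Integer.Properties as ℤₚ
open import Data.List using (List; []; _∷_; _++_; length)
open import Data.List.Relation.Unary.All as All using (All; []; _∷_)
import Data.List.Relation.Unary.All.Properties as Allₚ
open import Data.List.Relation.Unary.AllPairs using ([]; _∷_)
import Data.List.Relation.Unary.AllPairs.Properties as AllPairsₚ
open import Data.List.Relation.Unary.Any using (Any; here; there)
open import Data.List.Relation.Unary.Unique.Propositional using (Unique)
open import Data.Nat as ℕ using (zero; suc; _∸_; _<_; z≤n; s≤s; _≡ᵇ_; _≤ᵇ_; _<ᵇ_)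
open import Data.Nat.Induction using (<-rec)
import Data.Nat.Properties as ℕₚ
open import Data.Nat.Tactic.RingSolver using (solve-∀)
open import Data.Product using (∃; ∃₂; _,_; proj₁; proj₂)
open import Data.Rational as ℚ using (ℚ; 0ℚ; toℚᵘ; _/_) renaming (_+_ to _+ℚ_; _*_ to _*ℚ_; -_ to -ℚ_)
import Data.Rational.Properties as ℚₚ
open import Data.Rational.Solver using (module +-*-Solver)
import Data.Rational.Unnormalised as ℚᵘ
import Data.Rational.Unnormalised.Properties as ℚᵘₚ
open import Data.Sum as Sum using (_⊎_; inj₁; inj₂)
open import Data.Vec using (lookup; fromList)
open import Function.Base using (_∘_; case_of_)
open import Function.Bundles using (Inverse; mk↔ₛ′; mk⇔)
open import Relation.Binary.Definitions using (tri<; tri≈; tri>)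
open import Relation.Binary.PropositionalEquality using (_≢_; refl; sym; trans; cong; cong₂; subst; subst₂; module ≡-Reasoning)
open import Relation.Nullary using (Dec; yes; no; does; ¬?)
open import Relation.Nullary.Decidable using (_×-dec_)
open import Algebra.Properties.CommutativeMonoid.Sum ℚₚ.+-0-commutativeMonoid using (sum; sum-remove; ∑-distrib-+; ∑-comm; sum-cong-≗; sum-replicate-zero)
open import Algebra.Properties.Group ℚₚ.+-0-group using () renaming (∙-cancelˡ to +-cancelˡ)
open import Algebra.Properties.Semiring.Mult (CommutativeRing.semiring ℚₚ.+-*-commutativeRing) using () renaming (_×_ to _·_; ×-assocˡ to ·-assocˡ; ×-congʳ to ·-congʳ)
open import Algebra.Properties.Semiring.Sum (CommutativeRing.semiring ℚₚ.+-*-commutativeRing) using (*-distribˡ-sum)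

-- Both upper bounds use one principle: if an eigenvector for 1 is zero as soon as it is zero at s
-- chosen coordinates, the multiplicity is at most s. Equality is exploited through the same
-- principle. A coordinate determined by the others could be dropped, which would improve a bound
-- that is already attained; so the facts about inner neighbours, degrees and edges between
-- quasi-pendant vertices are all proved by exhibiting something redundant. The surplus 3 of
-- quasi-pendant vertices comes from the ends of the tree. Below any root, a deepest leaf hangs on a
-- quasi-pendant vertex of degree 2, whose parent has degree at least 3 because there is no pendant
-- P₃. The tree is rooted twice: an arbitrary root yields one such vertex, and rooting at that
-- vertex yields another. The large degree of the root's neighbour provides the third vertex. A
-- quasi-pendant root also starts the computation with the value 0 at the top, so that every inner
-- vertex has a parent. The two bounds then add up as 4m + 6 = 2(m + 3) + 2m.

without : {n : ℕ} → (Fin n → Bool) → Fin n → Fin n → Bool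
without f a i = f i ∧ not (does (i ≟ a))

true≢false : true ≢ false
true≢false ()

true-or-false : (b : Bool) → b ≡ true ⊎ b ≡ false
true-or-false true = inj₁ refl
true-or-false false = inj₂ refl

∧-true : {a b : Bool} → a ∧ b ≡ true → a ≡ true × b ≡ true
∧-true {true} {true} _ = refl , refl

∧-intro : {a b : Bool} → a ≡ true → b ≡ true → a ∧ b ≡ true
∧-intro refl refl = refl

≢⇒not-does : {n : ℕ} {i j : Fin n} → i ≢ j → not (does (i ≟ j)) ≡ true
≢⇒not-does {i = i} {j} ne with i ≟ j
... | yes e = ⊥-elim (ne e)
... | no _ = refl

without-⊆ : {n : ℕ} (f : Fin n → Bool) {a i : Fin n} → without f a i ≡ true → f i ≡ true
without-⊆ f {a} {i} h = proj₁ (∧-true {f i} h)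

without-≢ : {n : ℕ} (f : Fin n → Bool) {a i : Fin n} → without f a i ≡ true → i ≢ a
without-≢ f {a} {i} h i≡a with i ≟ a | proj₂ (∧-true {f i} h)
... | no i≢a | _ = i≢a i≡a

without-intro : {n : ℕ} (f : Fin n → Bool) {a i : Fin n} → f i ≡ true → i ≢ a → without f a i ≡ true
without-intro f fi i≢a = ∧-intro fi (≢⇒not-does i≢a)

-- Counting in finite sets

countF-cong : {n : ℕ} {f g : Fin n → Bool} → (∀ i → f i ≡ g i) → countF f ≡ countF g
countF-cong {zero} h = refl
countF-cong {suc n} h = cong₂ (λ b m → (if b then 1 else 0) + m) (h fzero) (countF-cong (h ∘ fsuc))

countF-without : {n : ℕ} (f : Fin n → Bool) (a : Fin n) → f a ≡ true →
  countF f ≡ suc (countF (without f a))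
countF-without f fzero fa rewrite fa = cong suc (countF-cong λ i → sym (Boolₚ.∧-identityʳ (f (fsuc i))))
countF-without f (fsuc a) fa rewrite Boolₚ.∧-identityʳ (f fzero) =
  trans (cong ((if f fzero then 1 else 0) +_) (countF-without (f ∘ fsuc) a fa)) (ℕₚ.+-suc _ _)

countF-witness : {n : ℕ} (f : Fin n → Bool) → 1 ≤ countF f → ∃ λ a → f a ≡ true
countF-witness {suc n} f h with true-or-false (f fzero)
... | inj₁ e = fzero , e
... | inj₂ e rewrite e = case countF-witness (f ∘ fsuc) h of λ (a , p) → fsuc a , p

countF-injection : {m n : ℕ} (f : Fin m → Bool) (g : Fin n → Bool) (h : Fin m → Fin n) →
  (∀ i → f i ≡ true → g (h i) ≡ true) →
  (∀ i j → f i ≡ true → f j ≡ true → h i ≡ h j → i ≡ j) → countF f ≤ countF g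
countF-injection {zero} f g h _ _ = z≤n
countF-injection {suc m} f g h into inj with true-or-false (f fzero)
... | inj₂ e rewrite e = countF-injection (f ∘ fsuc) g (h ∘ fsuc) (into ∘ fsuc)
        λ i j p q r → suc-injective (inj _ _ p q r)
... | inj₁ e rewrite e | countF-without g (h fzero) (into fzero e) =
  s≤s (countF-injection (f ∘ fsuc) (without g (h fzero)) (h ∘ fsuc)
    (λ i p → without-intro g (into _ p) λ r → case inj _ _ p e r of λ ())
    λ i j p q r → suc-injective (inj _ _ p q r))

countF-full : {n : ℕ} → countF {n} (λ _ → true) ≡ n
countF-full {zero} = refl
countF-full {suc n} = cong suc countF-full

countF-split : {n : ℕ} (f b : Fin n → Bool) →
  countF f ≡ countF (λ i → f i ∧ b i) + countF (λ i → f i ∧ not (b i))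
countF-split {zero} f b = refl
countF-split {suc n} f b with f fzero | b fzero
... | true | true = cong suc (countF-split (f ∘ fsuc) (b ∘ fsuc))
... | true | false = trans (cong suc (countF-split (f ∘ fsuc) (b ∘ fsuc))) (sym (ℕₚ.+-suc _ _))
... | false | _ = countF-split (f ∘ fsuc) (b ∘ fsuc)

countF≡1-unique : {n : ℕ} (f : Fin n → Bool) → countF f ≡ 1 → ∀ {a b} → f a ≡ true → f b ≡ true → a ≡ b
countF≡1-unique f h {a} {b} fa fb with a ≟ b
... | yes a≡b = a≡b
... | no a≢b = ⊥-elim (ℕₚ.1+n≢0 (ℕₚ.suc-injective (trans (cong suc (sym (countF-without (without f a) b (without-intro f fb (a≢b ∘ sym))))) (trans (sym (countF-without f a fa)) h))))

countF-other : {n : ℕ} (f : Fin n → Bool) → 2 ≤ countF f → (a : Fin n) → ∃ λ b → f b ≡ true × b ≢ a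
countF-other f h a with true-or-false (f a)
... | inj₁ e with countF-witness (without f a) (ℕ.s≤s⁻¹ (subst (2 ≤_) (countF-without f a e) h))
... | b , p = b , without-⊆ f p , without-≢ f p
countF-other f h a | inj₂ e with countF-witness f (ℕₚ.≤-trans (s≤s z≤n) h)
... | b , p = b , p , λ { refl → true≢false (trans (sym p) e) }

countF-third : {n : ℕ} (f : Fin n → Bool) → 3 ≤ countF f → (a c : Fin n) →
  ∃ λ b → f b ≡ true × b ≢ a × b ≢ c
countF-third f h a c with true-or-false (f a)
... | inj₁ e with countF-other (without f a) (ℕ.s≤s⁻¹ (subst (3 ≤_) (countF-without f a e) h)) c
... | b , p , q = b , without-⊆ f p , without-≢ f p , q
countF-third f h a c | inj₂ e with countF-other f (ℕₚ.≤-trans (s≤s (s≤s z≤n)) h) c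
... | b , p , q = b , p , (λ { refl → true≢false (trans (sym p) e) }) , q

enumerate : {n : ℕ} (f : Fin n → Bool) →
  Σ (Fin (countF f) → Fin n) λ e → ∀ i → f i ≡ true → ∃ λ s → e s ≡ i
enumerate {zero} f = (λ ()) , λ ()
enumerate {suc n} f with f fzero in eq | enumerate (f ∘ fsuc)
... | true | e , sur = (λ { fzero → fzero ; (fsuc s) → fsuc (e s) }) ,
  λ { fzero _ → fzero , refl ; (fsuc i) p → case sur i p of λ (s , q) → fsuc s , cong fsuc q }
... | false | e , sur = (λ s → fsuc (e s)) ,
  λ { fzero p → ⊥-elim (true≢false (trans (sym p) eq)) ; (fsuc i) p → case sur i p of λ (s , q) → s , cong fsuc q }

anyF-intro : {n : ℕ} (f : Fin n → Bool) (a : Fin n) → f a ≡ true → anyF f ≡ true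
anyF-intro f fzero p rewrite p = refl
anyF-intro f (fsuc a) p with f fzero
... | true = refl
... | false = anyF-intro (f ∘ fsuc) a p

anyF-witness : {n : ℕ} (f : Fin n → Bool) → anyF f ≡ true → ∃ λ a → f a ≡ true
anyF-witness {suc n} f p with f fzero in eq
... | true = fzero , eq
... | false = case anyF-witness (f ∘ fsuc) p of λ (a , q) → fsuc a , q

argmax : {n : ℕ} → Fin n → (f : Fin n → ℕ) → ∃ λ a → ∀ i → f i ≤ f a
argmax {suc zero} _ f = fzero , λ { fzero → ℕₚ.≤-refl }
argmax {suc (suc n)} _ f with argmax fzero (f ∘ fsuc)
... | a , m with ℕₚ.≤-total (f fzero) (f (fsuc a))
... | inj₁ h = fsuc a , λ { fzero → h ; (fsuc i) → m i }
... | inj₂ h = fzero , λ { fzero → ℕₚ.≤-refl ; (fsuc i) → ℕₚ.≤-trans (m i) h }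

-- Linear algebra over ℚ

sumℚ≡sum : {n : ℕ} (f : Fin n → ℚ) → sumℚ f ≡ sum f
sumℚ≡sum {zero} f = refl
sumℚ≡sum {suc n} f = cong (f fzero +ℚ_) (sumℚ≡sum (f ∘ fsuc))

sumℚ-cong : {n : ℕ} {f g : Fin n → ℚ} → (∀ i → f i ≡ g i) → sumℚ f ≡ sumℚ g
sumℚ-cong {f = f} {g} h = trans (sumℚ≡sum f) (trans (sum-cong-≗ h) (sym (sumℚ≡sum g)))

sumℚ-zero : {n : ℕ} {f : Fin n → ℚ} → (∀ i → f i ≡ 0ℚ) → sumℚ f ≡ 0ℚ
sumℚ-zero {n} h = trans (sumℚ-cong h) (trans (sumℚ≡sum {n} (λ _ → 0ℚ)) (sum-replicate-zero n))

sumℚ-+ : {n : ℕ} (f g : Fin n → ℚ) → sumℚ (λ i → f i +ℚ g i) ≡ sumℚ f +ℚ sumℚ g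
sumℚ-+ f g = trans (sumℚ≡sum (λ i → f i +ℚ g i))
  (trans (∑-distrib-+ f g) (sym (cong₂ _+ℚ_ (sumℚ≡sum f) (sumℚ≡sum g))))

sumℚ-* : {n : ℕ} (a : ℚ) (f : Fin n → ℚ) → sumℚ (λ i → a *ℚ f i) ≡ a *ℚ sumℚ f
sumℚ-* a f = trans (sumℚ≡sum (λ i → a *ℚ f i)) (trans (sym (*-distribˡ-sum a f)) (cong (a *ℚ_) (sym (sumℚ≡sum f))))

sumℚ-comm : {m n : ℕ} (f : Fin m → Fin n → ℚ) →
  sumℚ (λ i → sumℚ (f i)) ≡ sumℚ (λ j → sumℚ (λ i → f i j))
sumℚ-comm f = trans (sumℚ-cong (λ i → sumℚ≡sum (f i))) (trans (sumℚ≡sum (λ i → sum (f i)))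
  (trans (∑-comm f) (sym (trans (sumℚ-cong (λ j → sumℚ≡sum (λ i → f i j))) (sumℚ≡sum (λ j → sum (λ i → f i j)))))))

sumℚ-remove : {n : ℕ} (a : Fin (suc n)) (f : Fin (suc n) → ℚ) → sumℚ f ≡ f a +ℚ sumℚ (f ∘ punchIn a)
sumℚ-remove a f = trans (sumℚ≡sum f) (trans (sum-remove {i = a} f) (cong (f a +ℚ_) (sym (sumℚ≡sum (f ∘ punchIn a)))))

sumℚ-single : {n : ℕ} (a : Fin n) {f : Fin n → ℚ} → (∀ i → i ≢ a → f i ≡ 0ℚ) → sumℚ f ≡ f a
sumℚ-single fzero {f} h = trans (cong (f fzero +ℚ_) (sumℚ-zero (λ i → h (fsuc i) λ ()))) (ℚₚ.+-identityʳ _)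
sumℚ-single (fsuc a) {f} h = trans (cong₂ _+ℚ_ (h fzero λ ()) (sumℚ-single a (λ i i≢a → h (fsuc i) (i≢a ∘ suc-injective))))
  (ℚₚ.+-identityˡ _)

*-zero-divisor : (a b : ℚ) → a *ℚ b ≡ 0ℚ → a ≢ 0ℚ → b ≡ 0ℚ
*-zero-divisor a b ab≡0 a≢0 = begin
  b                  ≡⟨ ℚₚ.*-identityˡ b ⟨
  1ℚ *ℚ b            ≡⟨ cong (_*ℚ b) (ℚₚ.*-inverseˡ a) ⟨
  (a⁻¹ *ℚ a) *ℚ b    ≡⟨ ℚₚ.*-assoc a⁻¹ a b ⟩
  a⁻¹ *ℚ (a *ℚ b)    ≡⟨ cong (a⁻¹ *ℚ_) ab≡0 ⟩
  a⁻¹ *ℚ 0ℚ          ≡⟨ ℚₚ.*-zeroʳ a⁻¹ ⟩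
  0ℚ                 ∎
  where
  open ≡-Reasoning
  instance _ = ℚ.≢-nonZero a≢0
  a⁻¹ = ℚ.1/_ a

ι : ℕ → ℚ
ι n = (ℤ.+ n) / 1

ι-suc : ∀ n → ι (suc n) ≡ 1ℚ +ℚ ι n
ι-suc n = ℚₚ.toℚᵘ-injective (ℚᵘₚ.≃-trans (ℚₚ.toℚᵘ-fromℚᵘ (ℚᵘ.mkℚᵘ (ℤ.+ suc n) 0))
  (ℚᵘₚ.≃-trans (ℚᵘ.*≡* eq) (ℚᵘₚ.≃-sym (ℚᵘₚ.≃-trans (ℚₚ.toℚᵘ-homo-+ 1ℚ (ι n))
    (ℚᵘₚ.+-congʳ (toℚᵘ 1ℚ) (ℚₚ.toℚᵘ-fromℚᵘ (ℚᵘ.mkℚᵘ (ℤ.+ n) 0)))))))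
  where
  eq : (ℤ.+ suc n) ℤ.* ℤ.1ℤ ≡ (ℤ.1ℤ ℤ.+ ((ℤ.+ n) ℤ.* ℤ.1ℤ)) ℤ.* ℤ.1ℤ
  eq = cong (ℤ._* ℤ.1ℤ) (cong (λ z → ℤ.1ℤ ℤ.+ z) (sym (ℤₚ.*-identityʳ (ℤ.+ n))))

ι-* : ∀ n x → ι n *ℚ x ≡ n · x
ι-* zero x = ℚₚ.*-zeroˡ x
ι-* (suc n) x = trans (cong (_*ℚ x) (ι-suc n)) (trans (ℚₚ.*-distribʳ-+ x 1ℚ (ι n))
  (cong₂ _+ℚ_ (ℚₚ.*-identityˡ x) (ι-* n x)))

ι-suc≢0 : ∀ n → ι (suc n) ≢ 0ℚ
ι-suc≢0 n e with ℚᵘₚ.≃-trans (ℚᵘₚ.≃-sym (ℚₚ.toℚᵘ-fromℚᵘ (ℚᵘ.mkℚᵘ (ℤ.+ suc n) 0))) (ℚᵘₚ.≃-reflexive (cong toℚᵘ e))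
... | ℚᵘ.*≡* ()

·-cancel : ∀ n x → suc n · x ≡ 0ℚ → x ≡ 0ℚ
·-cancel n x h = *-zero-divisor (ι (suc n)) x (trans (ι-* (suc n) x) h) (ι-suc≢0 n)

-- Subtracting `x` leaves a positive multiple of `x`. It will be applied with the multiplier (deg x
-- - 1)(deg y - 1) of a pair of inner vertices.
·-fixed : ∀ n x → suc (suc n) · x ≡ x → x ≡ 0ℚ
·-fixed n x h = ·-cancel n x (+-cancelˡ x _ _ (trans h (sym (ℚₚ.+-identityʳ x))))

·-zeroʳ : ∀ n → n · 0ℚ ≡ 0ℚ
·-zeroʳ n = trans (sym (ι-* n 0ℚ)) (ℚₚ.*-zeroʳ (ι n))

-- Gaussian elimination without division: the pivot row is subtracted after cross-multiplication.
dependency : ∀ k {r} (M : Fin r → Fin k → ℚ) → k < r →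
  ∃ λ (c : Fin r → ℚ) → (∃ λ s → c s ≢ 0ℚ) × (∀ j → sumℚ (λ s → c s *ℚ M s j) ≡ 0ℚ)
dependency zero {suc r} M _ = (λ _ → 1ℚ) , (fzero , λ ()) , λ ()
dependency (suc k) {suc r} M (s≤s k<r) with any? (λ s → ¬? (M s fzero ℚₚ.≟ 0ℚ))
... | no allzero with dependency k (λ s j → M s (fsuc j)) (ℕₚ.<-trans k<r (ℕₚ.n<1+n r))
... | c , nz , ok = c , nz , λ { fzero → sumℚ-zero λ s → trans (cong (c s *ℚ_) (zero-col s)) (ℚₚ.*-zeroʳ (c s)) ; (fsuc j) → ok j }
  where
  zero-col : ∀ s → M s fzero ≡ 0ℚ
  zero-col s with M s fzero ℚₚ.≟ 0ℚ
  ... | yes e = e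
  ... | no ne = ⊥-elim (allzero (s , ne))
dependency (suc k) {suc r} M (s≤s k<r) | yes (a , pivot≢0)
  with dependency k (λ s j → (M a fzero *ℚ M (punchIn a s) (fsuc j)) +ℚ (-ℚ (M (punchIn a s) fzero)) *ℚ M a (fsuc j)) k<r
... | c′ , (s₀ , c′s₀≢0) , ok = c , (punchIn a s₀ , c≢0) , vanishes
  where
  open ≡-Reasoning
  piv = M a fzero
  σ = sumℚ (λ s → c′ s *ℚ M (punchIn a s) fzero)
  -- With `c′` scaled by the pivot, the other rows contribute `piv *ℚ σ` to the first column, which
  -- the coefficient `-ℚ σ` of the pivot row cancels.
  c : Fin (suc r) → ℚ
  c s with a ≟ s
  ... | yes _ = -ℚ σ
  ... | no a≢s = piv *ℚ c′ (punchOut a≢s)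
  c-pivot : c a ≡ -ℚ σ
  c-pivot with a ≟ a
  ... | yes _ = refl
  ... | no ne = ⊥-elim (ne refl)
  c-other : ∀ s → c (punchIn a s) ≡ piv *ℚ c′ s
  c-other s with a ≟ punchIn a s
  ... | yes e = ⊥-elim (punchInᵢ≢i a s (sym e))
    where open import Data.Fin.Properties using (punchInᵢ≢i)
  ... | no ne = cong (λ t → piv *ℚ c′ t) (punchOut-punchIn a)
    where open import Data.Fin.Properties using (punchOut-punchIn)
  c≢0 : c (punchIn a s₀) ≢ 0ℚ
  c≢0 e = c′s₀≢0 (*-zero-divisor piv (c′ s₀) (trans (sym (c-other s₀)) e) pivot≢0)
  expand : ∀ j → sumℚ (λ s → c s *ℚ M s j) ≡
    (-ℚ σ) *ℚ M a j +ℚ piv *ℚ sumℚ (λ s → c′ s *ℚ M (punchIn a s) j)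
  expand j = begin
    sumℚ (λ s → c s *ℚ M s j)
      ≡⟨ sumℚ-remove a (λ s → c s *ℚ M s j) ⟩
    c a *ℚ M a j +ℚ sumℚ (λ s → c (punchIn a s) *ℚ M (punchIn a s) j)
      ≡⟨ cong₂ _+ℚ_ (cong (_*ℚ M a j) c-pivot) (sumℚ-cong λ s →
           trans (cong (_*ℚ M (punchIn a s) j) (c-other s)) (ℚₚ.*-assoc piv (c′ s) _)) ⟩
    (-ℚ σ) *ℚ M a j +ℚ sumℚ (λ s → piv *ℚ (c′ s *ℚ M (punchIn a s) j))
      ≡⟨ cong ((-ℚ σ) *ℚ M a j +ℚ_) (sumℚ-* piv (λ s → c′ s *ℚ M (punchIn a s) j)) ⟩
    (-ℚ σ) *ℚ M a j +ℚ piv *ℚ sumℚ (λ s → c′ s *ℚ M (punchIn a s) j) ∎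
  cross : ∀ j → piv *ℚ sumℚ (λ s → c′ s *ℚ M (punchIn a s) (fsuc j)) +ℚ (-ℚ (M a (fsuc j))) *ℚ σ ≡ 0ℚ
  cross j = begin
    piv *ℚ sumℚ (λ s → c′ s *ℚ M (punchIn a s) (fsuc j)) +ℚ (-ℚ (M a (fsuc j))) *ℚ σ
      ≡⟨ cong₂ _+ℚ_ (sumℚ-* piv (λ s → c′ s *ℚ M (punchIn a s) (fsuc j)))
           (sumℚ-* (-ℚ (M a (fsuc j))) (λ s → c′ s *ℚ M (punchIn a s) fzero)) ⟨
    sumℚ (λ s → piv *ℚ (c′ s *ℚ M (punchIn a s) (fsuc j))) +ℚ
    sumℚ (λ s → (-ℚ (M a (fsuc j))) *ℚ (c′ s *ℚ M (punchIn a s) fzero))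
      ≡⟨ sumℚ-+ (λ s → piv *ℚ (c′ s *ℚ M (punchIn a s) (fsuc j)))
           (λ s → (-ℚ (M a (fsuc j))) *ℚ (c′ s *ℚ M (punchIn a s) fzero)) ⟨
    sumℚ (λ s → piv *ℚ (c′ s *ℚ M (punchIn a s) (fsuc j)) +ℚ (-ℚ (M a (fsuc j))) *ℚ (c′ s *ℚ M (punchIn a s) fzero))
      ≡⟨ sumℚ-cong (λ s → solve 5 (λ p c x y z → p :* (c :* x) :+ (:- y) :* (c :* z) := c :* (p :* x :+ (:- z) :* y)) refl
           piv (c′ s) (M (punchIn a s) (fsuc j)) (M a (fsuc j)) (M (punchIn a s) fzero)) ⟩
    sumℚ (λ s → c′ s *ℚ (piv *ℚ M (punchIn a s) (fsuc j) +ℚ (-ℚ (M (punchIn a s) fzero)) *ℚ M a (fsuc j)))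
      ≡⟨ ok j ⟩
    0ℚ ∎
    where open +-*-Solver
  vanishes : ∀ j → sumℚ (λ s → c s *ℚ M s j) ≡ 0ℚ
  vanishes fzero = trans (expand fzero) (solve 2 (λ s p → (:- s) :* p :+ p :* s := con 0ℚ) refl σ piv)
    where open +-*-Solver
  vanishes (fsuc j) = trans (expand (fsuc j)) (trans
    (solve 3 (λ s m t → (:- s) :* m :+ t := t :+ (:- m) :* s) refl σ (M a (fsuc j)) _) (cross j))
    where open +-*-Solver

-- With more than `countF f` independent vectors, some nontrivial combination vanishes at all
-- coordinates `h y`, hence everywhere, against independence. The map `h` separates what is counted
-- from where the value is read: the rooted bound counts children and reads at their parents.
multiplicity-bound : {n : ℕ} (G : Graph n) (μ : ℚ) (f : Fin n → Bool) (h : Fin n → Fin n) →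
  (∀ v → InEigenspace G μ v → (∀ y → f y ≡ true → v (h y) ≡ 0ℚ) → ∀ i → v i ≡ 0ℚ) →
  ∀ r → MultAtLeast G μ r → r ≤ countF f
multiplicity-bound {n} G μ f h forcing r (vs , indep , eigen) = ℕₚ.≮⇒≥ too-many
  where
  open ≡-Reasoning
  e = proj₁ (enumerate f)
  too-many : ¬ (countF f < r)
  too-many k<r with dependency (countF f) (λ s j → vs s (h (e j))) k<r
  ... | c , (s , cs≢0) , ok = cs≢0 (indep c (forcing v v-eigen v-vanishes) s)
    where
    v : Fin n → ℚ
    v i = sumℚ (λ s → c s *ℚ vs s i)
    v-vanishes : ∀ y → f y ≡ true → v (h y) ≡ 0ℚ
    v-vanishes y fy with proj₂ (enumerate f) y fy
    ... | j , refl = ok j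
    v-eigen : InEigenspace G μ v
    v-eigen i = begin
      sumℚ (λ j → laplacian G i j *ℚ v j)
        ≡⟨ sumℚ-cong (λ j → sym (sumℚ-* (laplacian G i j) (λ s → c s *ℚ vs s j))) ⟩
      sumℚ (λ j → sumℚ (λ s → laplacian G i j *ℚ (c s *ℚ vs s j)))
        ≡⟨ sumℚ-comm (λ j s → laplacian G i j *ℚ (c s *ℚ vs s j)) ⟩
      sumℚ (λ s → sumℚ (λ j → laplacian G i j *ℚ (c s *ℚ vs s j)))
        ≡⟨ sumℚ-cong (λ s → trans (sumℚ-cong (λ j → swap (laplacian G i j) (c s) (vs s j))) (sumℚ-* (c s) (λ j → laplacian G i j *ℚ vs s j))) ⟩
      sumℚ (λ s → c s *ℚ sumℚ (λ j → laplacian G i j *ℚ vs s j))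
        ≡⟨ sumℚ-cong (λ s → trans (cong (c s *ℚ_) (eigen s i)) (swap (c s) μ (vs s i))) ⟩
      sumℚ (λ s → μ *ℚ (c s *ℚ vs s i))
        ≡⟨ sumℚ-* μ (λ s → c s *ℚ vs s i) ⟩
      μ *ℚ v i ∎
      where
      swap : ∀ x y z → x *ℚ (y *ℚ z) ≡ y *ℚ (x *ℚ z)
      swap = solve 3 (λ x y z → x :* (y :* z) := y :* (x :* z)) refl
        where open +-*-Solver

-- The eigenvalue equations for 1

nbrSum : {n : ℕ} → Graph n → (Fin n → ℚ) → Fin n → ℚ
nbrSum G v i = sumℚ (λ j → if adj G i j then v j else 0ℚ)

-- Adding the neighbour sum cancels the off-diagonal entries. The degree acts as a natural multiple,
-- which unfolds on `suc`, so that one copy of `v i` can be cancelled once the degree is known to be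
-- a successor.
laplacian-row : {n : ℕ} (G : Graph n) (v : Fin n → ℚ) (i : Fin n) →
  sumℚ (λ j → laplacian G i j *ℚ v j) +ℚ nbrSum G v i ≡ deg G i · v i
laplacian-row G v i = trans
  (sym (sumℚ-+ (λ j → laplacian G i j *ℚ v j) (λ j → if adj G i j then v j else 0ℚ)))
  (trans (sumℚ-single i off) diag)
  where
  off : ∀ j → j ≢ i → laplacian G i j *ℚ v j +ℚ (if adj G i j then v j else 0ℚ) ≡ 0ℚ
  off j j≢i with i ≟ j
  ... | yes e = ⊥-elim (j≢i (sym e))
  ... | no _ with adj G i j
  ...   | true = solve 1 (λ x → (:- con 1ℚ) :* x :+ x := con 0ℚ) refl (v j)
    where open +-*-Solver
  ...   | false = solve 1 (λ x → con 0ℚ :* x :+ con 0ℚ := con 0ℚ) refl (v j)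
    where open +-*-Solver
  diag : laplacian G i i *ℚ v i +ℚ (if adj G i i then v i else 0ℚ) ≡ deg G i · v i
  diag with i ≟ i
  ... | no ne = ⊥-elim (ne refl)
  ... | yes _ rewrite adj-irrefl G i = trans (ℚₚ.+-identityʳ (ι (deg G i) *ℚ v i)) (ι-* (deg G i) (v i))

eigen-row : {n : ℕ} (G : Graph n) {v : Fin n → ℚ} → InEigenspace G 1ℚ v → ∀ i →
  v i +ℚ nbrSum G v i ≡ deg G i · v i
eigen-row G {v} eig i = trans (cong (_+ℚ nbrSum G v i) (sym (trans (eig i) (ℚₚ.*-identityˡ (v i))))) (laplacian-row G v i)

nbrSum-single : {n : ℕ} (G : Graph n) (v : Fin n → ℚ) {i x : Fin n} → adj G i x ≡ true →
  (∀ j → adj G i j ≡ true → j ≢ x → v j ≡ 0ℚ) → nbrSum G v i ≡ v x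
nbrSum-single G v {i} {x} ix h = trans (sumℚ-single x off) (cong (λ b → if b then v x else 0ℚ) ix)
  where
  off : ∀ j → j ≢ x → (if adj G i j then v j else 0ℚ) ≡ 0ℚ
  off j j≢x with adj G i j in ij
  ... | true = h j ij j≢x
  ... | false = refl

nbrSum-zero : {n : ℕ} (G : Graph n) (v : Fin n → ℚ) {i : Fin n} →
  (∀ j → adj G i j ≡ true → v j ≡ 0ℚ) → nbrSum G v i ≡ 0ℚ
nbrSum-zero G v {i} h = sumℚ-zero off
  where
  off : ∀ j → (if adj G i j then v j else 0ℚ) ≡ 0ℚ
  off j with adj G i j in ij
  ... | true = h j ij
  ... | false = refl

module _ {n : ℕ} (G : Graph n) {v : Fin n → ℚ} (eig : InEigenspace G 1ℚ v) where

  row-suc : ∀ {i d} → deg G i ≡ suc d → nbrSum G v i ≡ d · v i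
  row-suc {i} {d} h = +-cancelˡ (v i) _ _ (trans (eigen-row G eig i) (cong (_· v i) h))

  row-zero : ∀ {i} → v i ≡ 0ℚ → nbrSum G v i ≡ 0ℚ
  row-zero {i} h = +-cancelˡ (v i) _ _ (trans (eigen-row G eig i)
    (trans (trans (·-congʳ (deg G i) h) (·-zeroʳ (deg G i))) (sym (trans (ℚₚ.+-identityʳ _) h))))

  row-determines-nbr : ∀ {i x} → v i ≡ 0ℚ → adj G i x ≡ true →
    (∀ j → adj G i j ≡ true → j ≢ x → v j ≡ 0ℚ) → v x ≡ 0ℚ
  row-determines-nbr vi ix h = trans (sym (nbrSum-single G v ix h)) (row-zero vi)

  row-single : ∀ {i d x} → deg G i ≡ suc d → adj G i x ≡ true →
    (∀ j → adj G i j ≡ true → j ≢ x → v j ≡ 0ℚ) → v x ≡ d · v i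
  row-single di ix h = trans (sym (nbrSum-single G v ix h)) (row-suc di)

  -- The row reads `0 = (deg - 1) · v i`, which says nothing at a pendant vertex; hence the
  -- condition on the degree.
  row-isolated : ∀ {i} → 2 ≤ deg G i → (∀ j → adj G i j ≡ true → v j ≡ 0ℚ) → v i ≡ 0ℚ
  row-isolated {i} 2≤d h with deg G i in di
  row-isolated {i} (s≤s (s≤s {n = d} _)) h | _ = ·-cancel d (v i) (trans (sym (row-suc di)) (nbrSum-zero G v h))

-- Rooted trees

-- Acyclicity is kept in the form of `nbr-cases`: every edge is a parent edge. Nothing is said about
-- `par ρ`, hence the conditions `v ≢ ρ`.
record Rooted {n : ℕ} (G : Graph n) (ρ : Fin n) : Set where
  field
    par        : Fin n → Fin n
    depth      : Fin n → ℕ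
    par-adj    : ∀ {v} → v ≢ ρ → adj G v (par v) ≡ true
    depth-par  : ∀ {v} → v ≢ ρ → depth v ≡ suc (depth (par v))
    depth-root : depth ρ ≡ 0
    nbr-cases  : ∀ {u v} → adj G u v ≡ true → (u ≢ ρ × par u ≡ v) ⊎ (v ≢ ρ × par v ≡ u)

least : (f : ℕ → Bool) (k : ℕ) → f k ≡ true → ∃ λ m → f m ≡ true × (∀ j → f j ≡ true → m ≤ j)
least f zero fk = zero , fk , λ _ _ → z≤n
least f (suc k) fk with f 0 in f0
... | true = zero , f0 , λ _ _ → z≤n
... | false with least (f ∘ suc) k fk
...   | m , fm , min = suc m , fm , λ { zero h → ⊥-elim (true≢false (trans (sym h) f0)) ; (suc j) h → s≤s (min j h) }

adj-irreflexive : {n : ℕ} (G : Graph n) {u v : Fin n} → adj G u v ≡ true → u ≢ v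
adj-irreflexive G {u} uv refl = true≢false (trans (sym uv) (adj-irrefl G u))

adj-symmetric : {n : ℕ} (G : Graph n) {u v : Fin n} → adj G u v ≡ true → adj G v u ≡ true
adj-symmetric G uv = trans (adj-sym G _ _) uv

-- Chains, cycles and breadth-first search

module _ {n : ℕ} (G : Graph n) where

  -- The list contains both ends, so that it serves directly as the vertex vector of a `Cycle`.
  data Chain : Fin n → Fin n → List (Fin n) → Set where
    single : ∀ {a} → Chain a a (a ∷ [])
    cons   : ∀ {a b c xs} → adj G a b ≡ true → Chain b c (b ∷ xs) → Chain a c (a ∷ b ∷ xs)

  snoc : ∀ {a b c xs} → Chain a b xs → adj G b c ≡ true → Chain a c (xs ++ c ∷ [])
  snoc single bc = cons bc single
  snoc (cons ab ch) bc = cons ab (snoc ch bc)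

  chain-last : ∀ {a c x xs} → Chain a c (x ∷ xs) → lookup (fromList (x ∷ xs)) (fromℕ (length xs)) ≡ c
  chain-last single = refl
  chain-last (cons _ ch) = chain-last ch

  chain-consec : ∀ {a c x xs} → Chain a c (x ∷ xs) → ∀ (i : Fin (length xs)) →
    adj G (lookup (fromList (x ∷ xs)) (inject₁ i)) (lookup (fromList xs) i) ≡ true
  chain-consec (cons ab ch) fzero = ab
  chain-consec (cons ab ch) (fsuc i) = chain-consec ch i

  all-lookup : {P : Fin n → Set} {xs : List (Fin n)} → All P xs → ∀ i → P (lookup (fromList xs) i)
  all-lookup (px ∷ _) fzero = px
  all-lookup (_ ∷ pxs) (fsuc i) = all-lookup pxs i

  unique-lookup : {xs : List (Fin n)} → Unique xs → ∀ i j →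
    lookup (fromList xs) i ≡ lookup (fromList xs) j → i ≡ j
  unique-lookup (_ ∷ _) fzero fzero _ = refl
  unique-lookup (x∉ ∷ _) fzero (fsuc j) e = ⊥-elim (all-lookup x∉ j e)
  unique-lookup (x∉ ∷ _) (fsuc i) fzero e = ⊥-elim (all-lookup x∉ i (sym e))
  unique-lookup (_ ∷ u) (fsuc i) (fsuc j) e = cong fsuc (unique-lookup u i j e)

  closed-chain : ∀ {a b x y z xs} → Chain a b (x ∷ y ∷ z ∷ xs) → Unique (x ∷ y ∷ z ∷ xs) →
    adj G b a ≡ true → Cycle G
  closed-chain {a} {x = x} {y} {z} {xs} ch@(cons _ _) u ba = record
    { len = length xs
    ; vs = fromList (x ∷ y ∷ z ∷ xs)
    ; distinct = unique-lookup u
    ; consec = chain-consec ch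
    ; closing = subst (λ t → adj G t a ≡ true) (sym (chain-last ch)) ba
    }

  unique-snoc : ∀ {xs : List (Fin n)} {c} → Unique xs → All (_≢ c) xs → Unique (xs ++ c ∷ [])
  unique-snoc u h = AllPairsₚ.++⁺ {R = _≢_} u ([] ∷ []) (All.map (λ e → e ∷ []) h)

  module BFS (acyclic : Acyclic G) (connected : Connected G) (ρ : Fin n) where

    -- The walk to `ρ` has length exactly `k`, not at most `k`; the distance is the least such `k`.
    reach : ℕ → Fin n → Bool
    reach zero v = does (v ≟ ρ)
    reach (suc k) v = anyF (λ u → adj G v u ∧ reach k u)

    reach-root : reach 0 ρ ≡ true
    reach-root with ρ ≟ ρ
    ... | yes _ = refl
    ... | no ne = ⊥-elim (ne refl)

    reach-zero : ∀ {v} → reach 0 v ≡ true → v ≡ ρ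
    reach-zero {v} h with v ≟ ρ
    ... | yes e = e

    reach-walk : ∀ {v} → Walk G v ρ → ∃ λ k → reach k v ≡ true
    reach-walk here = 0 , reach-root
    reach-walk (step uv w) with reach-walk w
    ... | k , h = suc k , anyF-intro (λ u → adj G _ u ∧ reach k u) _ (∧-intro uv h)

    shortest : ∀ v → ∃ λ m → reach m v ≡ true × (∀ j → reach j v ≡ true → m ≤ j)
    shortest v with reach-walk (connected v ρ)
    ... | k , h = least (λ j → reach j v) k h

    dist : Fin n → ℕ
    dist v = proj₁ (shortest v)

    reach-dist : ∀ v → reach (dist v) v ≡ true
    reach-dist v = proj₁ (proj₂ (shortest v))

    dist-min : ∀ {v} j → reach j v ≡ true → dist v ≤ j
    dist-min {v} = proj₂ (proj₂ (shortest v))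

    dist-root : dist ρ ≡ 0
    dist-root = ℕₚ.n≤0⇒n≡0 (dist-min 0 reach-root)

    dist-adj : ∀ {u v} → adj G u v ≡ true → dist u ≤ suc (dist v)
    dist-adj {u} {v} uv = dist-min (suc (dist v)) (anyF-intro (λ w → adj G u w ∧ reach (dist v) w) v (∧-intro uv (reach-dist v)))

    parent : ∀ v → ∃ λ u → v ≢ ρ → adj G v u ≡ true × dist v ≡ suc (dist u)
    parent v with dist v in dv | reach-dist v
    ... | zero | h = ρ , λ v≢ρ → ⊥-elim (v≢ρ (reach-zero h))
    ... | suc k | h with anyF-witness (λ u → adj G v u ∧ reach k u) h
    ...   | u , vu∧ku with ∧-true {adj G v u} vu∧ku
    ...     | vu , ku = u , λ _ → vu , cong suc (ℕₚ.≤-antisym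
      (ℕ.s≤s⁻¹ (subst (_≤ suc (dist u)) dv (dist-adj vu))) (dist-min k ku))

    up : Fin n → Fin n
    up v = proj₁ (parent v)

    up-adj : ∀ {v} → v ≢ ρ → adj G v (up v) ≡ true
    up-adj {v} h = proj₁ (proj₂ (parent v) h)

    dist-up : ∀ {v} → v ≢ ρ → dist v ≡ suc (dist (up v))
    dist-up {v} h = proj₂ (proj₂ (parent v) h)

    dist-zero : ∀ {v} → dist v ≡ 0 → v ≡ ρ
    dist-zero {v} h = reach-zero (subst (λ k → reach k v ≡ true) h (reach-dist v))

    dist-suc : ∀ {v d} → dist v ≡ suc d → v ≢ ρ
    dist-suc h refl = case trans (sym h) dist-root of λ ()

    -- A path between two vertices of equal depth whose vertices are at least that deep can be
    -- extended by the two parents; it closes up to a cycle at the first common ancestor.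
    no-level-chain : ∀ d {a b x y xs} → Chain a b (x ∷ y ∷ xs) → Unique (x ∷ y ∷ xs) →
      dist a ≡ d → dist b ≡ d → All (λ x → d ≤ dist x) (x ∷ y ∷ xs) → a ≢ b → ⊥
    no-level-chain zero _ _ da db _ a≢b = a≢b (trans (dist-zero da) (sym (dist-zero db)))
    no-level-chain (suc d) {a} {b} {x} {y} {xs} ch@(cons _ _) u da db deep a≢b with up a ≟ up b
    ... | yes e = acyclic (closed-chain (cons (adj-symmetric G (up-adj a≢ρ)) ch) (All.map (λ h e′ → above h (cong dist (sym e′)) ) deep ∷ u)
            (subst (λ t → adj G b t ≡ true) (sym e) (up-adj b≢ρ)))
      where
      a≢ρ = dist-suc da
      b≢ρ = dist-suc db
      above : ∀ {z} → suc d ≤ dist z → dist z ≢ dist (up a)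
      above h e′ = ℕₚ.1+n≰n (subst (suc d ≤_) (trans e′ (ℕₚ.suc-injective (trans (sym (dist-up a≢ρ)) da))) h)
    ... | no ne = no-level-chain d
            (cons (adj-symmetric G (up-adj a≢ρ)) (snoc ch (up-adj b≢ρ)))
            (Allₚ.++⁺ (All.map (λ h e → above h (subst (λ t → dist t ≡ d) e dua)) deep) (ne ∷ [])
              ∷ unique-snoc u (All.map (λ h e → above h (subst (λ t → dist t ≡ d) (sym e) dub)) deep))
            dua dub
            (ℕₚ.≤-reflexive (sym dua) ∷ Allₚ.++⁺ (All.map (ℕₚ.≤-trans (ℕₚ.n≤1+n d)) deep) (ℕₚ.≤-reflexive (sym dub) ∷ []))
            ne
      where
      a≢ρ = dist-suc da
      b≢ρ = dist-suc db
      dua : dist (up a) ≡ d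
      dua = ℕₚ.suc-injective (trans (sym (dist-up a≢ρ)) da)
      dub : dist (up b) ≡ d
      dub = ℕₚ.suc-injective (trans (sym (dist-up b≢ρ)) db)
      above : ∀ {z} → suc d ≤ dist z → dist z ≢ d
      above h e = ℕₚ.1+n≰n (subst (suc d ≤_) e h)

    -- Were `up v` different from `u`, the chain `u`, `v`, `up v` would join two vertices of equal
    -- depth without rising above them.
    up-of-deeper : ∀ {u v} → adj G u v ≡ true → dist v ≡ suc (dist u) → up v ≡ u
    up-of-deeper {u} {v} uv dv with up v ≟ u
    ... | yes e = e
    ... | no ne = ⊥-elim (no-level-chain (dist u)
      (cons uv (cons (up-adj v≢ρ) single))
      ((adj-irreflexive G uv ∷ (ne ∘ sym) ∷ []) ∷ (adj-irreflexive G (up-adj v≢ρ) ∷ []) ∷ [] ∷ [])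
      refl d-up
      (ℕₚ.≤-refl ∷ subst (dist u ≤_) (sym dv) (ℕₚ.n≤1+n _) ∷ ℕₚ.≤-reflexive (sym d-up) ∷ [])
      (ne ∘ sym))
      where
      v≢ρ = dist-suc dv
      d-up : dist (up v) ≡ dist u
      d-up = ℕₚ.suc-injective (trans (sym (dist-up v≢ρ)) dv)

    up-cases : ∀ {u v} → adj G u v ≡ true → (u ≢ ρ × up u ≡ v) ⊎ (v ≢ ρ × up v ≡ u)
    up-cases {u} {v} uv with ℕₚ.<-cmp (dist u) (dist v)
    ... | tri< u<v _ _ = let dv = ℕₚ.≤-antisym (dist-adj (adj-symmetric G uv)) u<v in inj₂ (dist-suc dv , up-of-deeper uv dv)
    -- An edge inside one level is itself a forbidden chain.
    ... | tri≈ _ u≈v _ = ⊥-elim (no-level-chain (dist v) (cons uv single)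
      ((adj-irreflexive G uv ∷ []) ∷ [] ∷ []) u≈v refl
      (ℕₚ.≤-reflexive (sym u≈v) ∷ ℕₚ.≤-refl ∷ []) (adj-irreflexive G uv))
    ... | tri> _ _ v<u = let du = ℕₚ.≤-antisym (dist-adj uv) v<u in inj₁ (dist-suc du , up-of-deeper (adj-symmetric G uv) du)

    rooted : Rooted G ρ
    rooted = record
      { par = up ; depth = dist ; par-adj = up-adj ; depth-par = dist-up ; depth-root = dist-root ; nbr-cases = up-cases }

choose : {n : ℕ} → (Fin n → Bool) → Fin n → Fin n
choose f d with any? (λ a → f a Boolₚ.≟ true)
... | yes (a , _) = a
... | no _ = d

choose-true : {n : ℕ} (f : Fin n → Bool) (d : Fin n) {a : Fin n} → f a ≡ true → f (choose f d) ≡ true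
choose-true f d {a} fa with any? (λ a → f a Boolₚ.≟ true)
... | yes (_ , h) = h
... | no ne = ⊥-elim (ne (a , fa))

walk-closed : {n : ℕ} (G : Graph n) (P : Fin n → Set) → (∀ {u v} → P u → adj G u v ≡ true → P v) →
  ∀ {u v} → Walk G u v → P u → P v
walk-closed G P closed here Pu = Pu
walk-closed G P closed (step e w) Pu = walk-closed G P closed w (closed Pu e)

no-four-cycle : {n : ℕ} (G : Graph n) → Acyclic G → ∀ {x y x′ y′} → x ≢ x′ →
  adj G x y ≡ true → adj G y x′ ≡ true → adj G x′ y′ ≡ true → adj G y′ x ≡ true → y ≡ y′
no-four-cycle G acyclic {x} {y} {x′} {y′} x≢x′ xy yx′ x′y′ y′x with y ≟ y′
... | yes e = e
... | no ne = ⊥-elim (acyclic (closed-chain G (cons xy (cons yx′ (cons x′y′ single)))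
  ((irr xy ∷ x≢x′ ∷ (irr y′x ∘ sym) ∷ []) ∷ (irr yx′ ∷ ne ∷ []) ∷ (irr x′y′ ∷ []) ∷ [] ∷ []) y′x))
  where
  irr : ∀ {u v} → adj G u v ≡ true → u ≢ v
  irr = adj-irreflexive G

-- Pendant, quasi-pendant and inner vertices

module Classes {n : ℕ} (G : Graph n) where

  Pendant Quasi Inner : Fin n → Set
  Pendant u = isPendant G u ≡ true
  Quasi u = isQuasiPendant G u ≡ true

  inner : Fin n → Bool
  inner u = not (isPendant G u) ∧ not (isQuasiPendant G u)

  Inner u = inner u ≡ true

  sym-adj : ∀ {u v} → adj G u v ≡ true → adj G v u ≡ true
  sym-adj = adj-symmetric G

  pendant-deg : ∀ {u} → Pendant u → deg G u ≡ 1
  pendant-deg {u} h = ℕₚ.≡ᵇ⇒≡ (deg G u) 1 (subst T (sym h) _)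

  pendant-nbr-unique : ∀ {u a b} → Pendant u → adj G u a ≡ true → adj G u b ≡ true → a ≡ b
  pendant-nbr-unique {u} h = countF≡1-unique (adj G u) (pendant-deg h)

  two-nbrs⇒¬pendant : ∀ {u a b} → adj G u a ≡ true → adj G u b ≡ true → a ≢ b → ¬ Pendant u
  two-nbrs⇒¬pendant ua ub a≢b h = a≢b (pendant-nbr-unique h ua ub)

  quasi-intro : ∀ {w u} → adj G w u ≡ true → Pendant u → Quasi w
  quasi-intro {w} {u} wu h = anyF-intro (λ j → adj G w j ∧ isPendant G j) u (∧-intro wu h)

  pen : Fin n → Fin n
  pen w = choose (λ j → adj G w j ∧ isPendant G j) w

  pen-spec : ∀ {w} → Quasi w → adj G w (pen w) ∧ isPendant G (pen w) ≡ true
  pen-spec {w} h = choose-true (λ j → adj G w j ∧ isPendant G j) w (proj₂ (anyF-witness (λ j → adj G w j ∧ isPendant G j) h))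

  pen-adj : ∀ {w} → Quasi w → adj G w (pen w) ≡ true
  pen-adj {w} h = proj₁ (∧-true {adj G w (pen w)} (pen-spec h))

  pen-pendant : ∀ {w} → Quasi w → Pendant (pen w)
  pen-pendant {w} h = proj₂ (∧-true {adj G w (pen w)} (pen-spec h))

  inner-¬pendant : ∀ {u} → Inner u → ¬ Pendant u
  inner-¬pendant {u} h e with isPendant G u
  inner-¬pendant {u} () refl | true

  inner-¬quasi : ∀ {u} → Inner u → ¬ Quasi u
  inner-¬quasi {u} h e with isPendant G u | isQuasiPendant G u
  inner-¬quasi {u} () refl | true | true
  inner-¬quasi {u} () refl | false | true

  inner-nbr : ∀ {u v} → Inner u → adj G u v ≡ true → ¬ Pendant v
  inner-nbr h uv e = inner-¬quasi h (quasi-intro uv e)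

  quasi? : ∀ u → Dec (Quasi u)
  quasi? u = isQuasiPendant G u Boolₚ.≟ true

  pendant? : ∀ u → Dec (Pendant u)
  pendant? u = isPendant G u Boolₚ.≟ true

  inner? : ∀ u → Dec (Inner u)
  inner? u = inner u Boolₚ.≟ true

  inner-intro : ∀ {u} → ¬ Pendant u → ¬ Quasi u → Inner u
  inner-intro hp hq = ∧-intro (cong not (Boolₚ.¬-not hp)) (cong not (Boolₚ.¬-not hq))

  quasi-or-inner : ∀ {u} → ¬ Pendant u → Quasi u ⊎ Inner u
  quasi-or-inner {u} h with quasi? u
  ... | yes hq = inj₁ hq
  ... | no hq = inj₂ (inner-intro h hq)

  module _ {v : Fin n → ℚ} (eig : InEigenspace G 1ℚ v) where

    -- The pendant neighbour has degree `suc 0`, so its row equates `v w` with zero times its own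
    -- value.
    quasi-vanishes : ∀ {w} → Quasi w → v w ≡ 0ℚ
    quasi-vanishes {w} h = row-single G eig (pendant-deg pd) uw λ j uj j≢w → ⊥-elim (j≢w (pendant-nbr-unique pd uj uw))
      where
      pd = pen-pendant h
      uw = sym-adj (pen-adj h)

module PendantTree {n : ℕ} (G : Graph n) (tree : IsTree G) (6≤n : 6 ≤ n) (p≡q : p G ≡ q G) where

  open Classes G public

  connected : Connected G
  connected = proj₁ tree

  acyclic : Acyclic G
  acyclic = proj₂ tree

  other-vertex : ∀ a → ∃ λ (b : Fin n) → b ≢ a
  other-vertex a with countF-other {n} (λ _ → true) (subst (2 ≤_) (sym countF-full) (ℕₚ.≤-trans (s≤s (s≤s z≤n)) 6≤n)) a
  ... | b , _ , ne = b , ne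

  third-vertex : ∀ a c → ∃ λ (b : Fin n) → b ≢ a × b ≢ c
  third-vertex a c with countF-third {n} (λ _ → true) (subst (3 ≤_) (sym countF-full) (ℕₚ.≤-trans (s≤s (s≤s (s≤s z≤n))) 6≤n)) a c
  ... | b , _ , ne = b , ne

  some-nbr : ∀ u → ∃ λ v → adj G u v ≡ true
  some-nbr u with other-vertex u
  ... | b , b≢u with connected u b
  ...   | here = ⊥-elim (b≢u refl)
  ...   | step {j = j} uj _ = j , uj

  ¬pendant⇒2≤deg : ∀ {u} → ¬ Pendant u → 2 ≤ deg G u
  ¬pendant⇒2≤deg {u} h with deg G u in du | some-nbr u
  ... | suc (suc d) | _ = s≤s (s≤s z≤n)
  ... | suc zero | _ = ⊥-elim (h refl)
  ... | zero | (v , uv) = case trans (sym (countF-without (adj G u) v uv)) du of λ ()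

  -- Two adjacent pendant vertices form a whole component, which is too small for a connected graph
  -- on at least 6 vertices.
  pendant-¬quasi : ∀ {u} → Pendant u → ¬ Quasi u
  pendant-¬quasi {u} hu hq with third-vertex u (pen u)
  ... | b , b≢u , b≢w with walk-closed G (λ x → x ≡ u ⊎ x ≡ pen u) closed (connected u b) (inj₁ refl)
    where
    closed : ∀ {x y} → x ≡ u ⊎ x ≡ pen u → adj G x y ≡ true → y ≡ u ⊎ y ≡ pen u
    closed (inj₁ refl) xy = inj₂ (pendant-nbr-unique hu xy (pen-adj hq))
    closed (inj₂ refl) xy = inj₁ (pendant-nbr-unique (pen-pendant hq) xy (sym-adj (pen-adj hq)))
  ...   | inj₁ e = b≢u e
  ...   | inj₂ e = b≢w e

  -- Otherwise q < p: quasi-pendant vertices would inject into the pendant vertices other than u′.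
  pendant-unique : ∀ {w u u′} → adj G w u ≡ true → adj G w u′ ≡ true → Pendant u → Pendant u′ → u ≡ u′
  pendant-unique {w} {u} {u′} wu wu′ hu hu′ with u ≟ u′
  ... | yes e = e
  ... | no u≢u′ = ⊥-elim (ℕₚ.1+n≰n (ℕₚ.≤-trans (ℕₚ.≤-reflexive (trans (sym (countF-without (isPendant G) u′ hu′)) p≡q))
          (countF-injection (isQuasiPendant G) (without (isPendant G) u′) h into inj)))
    where
    h : Fin n → Fin n
    -- `pen w` might be `u′`, so the value at `w` is prescribed as `u`. At any other vertex the
    -- value differs from `u′`, whose only neighbour is `w`.
    h x with x ≟ w
    ... | yes _ = u
    ... | no _ = pen x
    h-adj : ∀ x → Quasi x → adj G x (h x) ≡ true
    h-adj x hq with x ≟ w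
    ... | yes refl = wu
    ... | no _ = pen-adj hq
    h-pendant : ∀ x → Quasi x → Pendant (h x)
    h-pendant x hq with x ≟ w
    ... | yes _ = hu
    ... | no _ = pen-pendant hq
    h-avoids : ∀ x → Quasi x → h x ≢ u′
    h-avoids x hq with x ≟ w
    ... | yes _ = u≢u′
    ... | no x≢w = λ e → x≢w (pendant-nbr-unique hu′ (sym-adj (subst (λ t → adj G x t ≡ true) e (pen-adj hq))) (sym-adj wu′))
    into : ∀ x → Quasi x → without (isPendant G) u′ (h x) ≡ true
    into x hq = without-intro (isPendant G) (h-pendant x hq) (h-avoids x hq)
    inj : ∀ x y → Quasi x → Quasi y → h x ≡ h y → x ≡ y
    inj x y hx hy e = pendant-nbr-unique (h-pendant x hx) (sym-adj (h-adj x hx)) (sym-adj (subst (λ t → adj G y t ≡ true) (sym e) (h-adj y hy)))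

  order-by-class : n ≡ q G + q G + countF inner
  order-by-class = trans (sym countF-full) (trans (countF-split (λ _ → true) (isPendant G))
    (trans (cong (p G +_) (trans (countF-split (λ i → not (isPendant G i)) (isQuasiPendant G))
      (cong (_+ countF inner) (countF-cong quasi-nonpendant))))
    (trans (cong (_+ (q G + countF inner)) p≡q) (sym (ℕₚ.+-assoc (q G) (q G) _)))))
    where
    quasi-nonpendant : ∀ i → not (isPendant G i) ∧ isQuasiPendant G i ≡ isQuasiPendant G i
    quasi-nonpendant i with isPendant G i in pi | isQuasiPendant G i in qi
    ... | true | true = ⊥-elim (pendant-¬quasi pi qi)
    ... | true | false = refl
    ... | false | _ = refl

  -- A pendant value is read off from the equation at its neighbour. This works because p = q leaves
  -- that neighbour with a single pendant neighbour, so every other term is already known to be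
  -- zero.
  eigenvector-vanishes : ∀ {v} → InEigenspace G 1ℚ v → (∀ x → Inner x → v x ≡ 0ℚ) → ∀ x → v x ≡ 0ℚ
  eigenvector-vanishes {v} eig h x with pendant? x
  ... | no hx with quasi-or-inner hx
  ...   | inj₁ hq = quasi-vanishes eig hq
  ...   | inj₂ hi = h x hi
  eigenvector-vanishes {v} eig h x | yes hx with some-nbr x
  ... | w , xw = row-determines-nbr G eig (quasi-vanishes eig hw) (sym-adj xw) others
    where
    hw = quasi-intro (sym-adj xw) hx
    others : ∀ j → adj G w j ≡ true → j ≢ x → v j ≡ 0ℚ
    others j wj j≢x with pendant? j
    ... | yes hj = ⊥-elim (j≢x (pendant-unique wj (sym-adj xw) hj hx))
    ... | no hj with quasi-or-inner hj
    ...   | inj₁ hq = quasi-vanishes eig hq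
    ...   | inj₂ hi = h j hi

  -- An inner vertex has no pendant neighbour, so its neighbours all vanish, and its own equation
  -- with degree at least 2 leaves only zero.
  inner-vanishes : ∀ {v x} → InEigenspace G 1ℚ v → Inner x →
    (∀ j → adj G x j ≡ true → Inner j → v j ≡ 0ℚ) → v x ≡ 0ℚ
  inner-vanishes {v} {x} eig hx h = row-isolated G eig (¬pendant⇒2≤deg (inner-¬pendant hx)) others
    where
    others : ∀ j → adj G x j ≡ true → v j ≡ 0ℚ
    others j xj with quasi-or-inner (inner-nbr hx xj)
    ... | inj₁ hq = quasi-vanishes eig hq
    ... | inj₂ hi = h j xj hi

  -- The bound by a colour class, and its equality case

  module Coloured (col : Fin n → Bool) (proper : ∀ {u v} → adj G u v ≡ true → col v ≡ not (col u)) where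

    innerCol : Fin n → Bool
    innerCol x = inner x ∧ col x

    -- The equations at the inner vertices of the other colour express their values by those on innerCol.
    colour-forces : ∀ {v} → InEigenspace G 1ℚ v → (∀ x → innerCol x ≡ true → v x ≡ 0ℚ) → ∀ x → v x ≡ 0ℚ
    colour-forces {v} eig h = eigenvector-vanishes eig on-inner
      where
      on-inner : ∀ x → Inner x → v x ≡ 0ℚ
      on-inner x hx with true-or-false (col x)
      ... | inj₁ cx = h x (∧-intro hx cx)
      ... | inj₂ cx = inner-vanishes eig hx λ j xj hj → h j (∧-intro hj (trans (proper xj) (cong not cx)))

    colour-bound : ∀ r → MultAtLeast G 1ℚ r → r ≤ countF innerCol
    colour-bound = multiplicity-bound G 1ℚ innerCol (λ x → x) λ v eig → colour-forces eig

    module Tight (r : ℕ) (mult : MultAtLeast G 1ℚ r) (tight : countF innerCol ≤ r) where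

      -- If the remaining coordinates of the class determined `v x`, the class without `x` would
      -- still determine every eigenvector and would bound the multiplicity by less than `r`.
      essential : ∀ {x} → Inner x → col x ≡ true →
        ¬ (∀ v → InEigenspace G 1ℚ v → (∀ y → innerCol y ≡ true → y ≢ x → v y ≡ 0ℚ) → v x ≡ 0ℚ)
      essential {x} hx cx redundant = ℕₚ.1+n≰n (ℕₚ.≤-trans
        (ℕₚ.≤-trans (ℕₚ.≤-reflexive (sym (countF-without innerCol x (∧-intro hx cx)))) tight)
        (multiplicity-bound G 1ℚ (without innerCol x) (λ y → y) forcing r mult))
        where
        forcing : ∀ v → InEigenspace G 1ℚ v → (∀ y → without innerCol x y ≡ true → v y ≡ 0ℚ) → ∀ y → v y ≡ 0ℚ
        forcing v eig h = colour-forces eig λ y hy → on y hy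
          where
          on : ∀ y → innerCol y ≡ true → v y ≡ 0ℚ
          on y hy with y ≟ x
          ... | yes refl = redundant v eig λ z hz z≢x → h z (without-intro innerCol hz z≢x)
          ... | no y≢x = h y (without-intro innerCol hy y≢x)

      -- If all neighbours were quasi-pendant, the equation at `x` alone would give `v x ≡ 0ℚ`, and
      -- the coordinate at `x` would be redundant.
      inner-has-inner-nbr : ∀ {x} → Inner x → col x ≡ true → ∃ λ y → adj G x y ≡ true × Inner y
      inner-has-inner-nbr {x} hx cx with any? (λ y → (adj G x y Boolₚ.≟ true) ×-dec inner? y)
      ... | yes found = found
      ... | no none = ⊥-elim (essential hx cx λ v eig _ → inner-vanishes eig hx λ j xj hj → ⊥-elim (none (j , xj , hj)))

      -- Suppose the class vanishes off `x′`. The equation at `x`, where the other neighbours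
      -- vanish, gives `v y ≡ 0ℚ`; then the equation at `y` gives `v x′ ≡ 0ℚ`. So the coordinate at
      -- `x′` would be redundant.
      no-common-inner-nbr : ∀ {x x′ y} → Inner x → Inner x′ → Inner y → col x′ ≡ true →
        adj G y x ≡ true → adj G y x′ ≡ true → x ≡ x′
      no-common-inner-nbr {x} {x′} {y} hx hx′ hy cx′ yx yx′ with x ≟ x′
      ... | yes e = e
      ... | no x≢x′ = ⊥-elim (essential hx′ cx′ vanish)
        where
        cy : col y ≡ false
        cy = trans (proper (sym-adj yx′)) (cong not cx′)
        nbr-col : ∀ {z j} → col z ≡ false → adj G z j ≡ true → col j ≡ true
        nbr-col cz zj = trans (proper zj) (cong not cz)
        cx : col x ≡ true
        cx = nbr-col cy yx
        vanish : ∀ v → InEigenspace G 1ℚ v → (∀ z → innerCol z ≡ true → z ≢ x′ → v z ≡ 0ℚ) → v x′ ≡ 0ℚ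
        vanish v eig h = row-determines-nbr G eig vy yx′ λ j yj j≢x′ → nonpendant-case (inner-nbr hy yj) λ hj → h j (∧-intro hj (nbr-col cy yj)) j≢x′
          where
          nonpendant-case : ∀ {j} → ¬ Pendant j → (Inner j → v j ≡ 0ℚ) → v j ≡ 0ℚ
          nonpendant-case hj k with quasi-or-inner hj
          ... | inj₁ hq = quasi-vanishes eig hq
          ... | inj₂ hi = k hi
          -- The inner neighbours of `j` lie in the class of `x′` and vanish unless one of them is
          -- `x′` itself, which would close the four-cycle `x`, `y`, `x′`, `j`.
          around : ∀ j → adj G x j ≡ true → j ≢ y → Inner j → v j ≡ 0ℚ
          around j xj j≢y hj = inner-vanishes eig hj λ z jz hz → h z (∧-intro hz (nbr-col (trans (proper xj) (cong not cx)) jz))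
            λ { refl → j≢y (sym (no-four-cycle G acyclic x≢x′ (sym-adj yx) yx′ (sym-adj jz) (sym-adj xj))) }
          vy : v y ≡ 0ℚ
          vy = row-determines-nbr G eig (h x (∧-intro hx cx) x≢x′) (sym-adj yx) λ j xj j≢y → nonpendant-case (inner-nbr hx xj) (around j xj j≢y)

      -- For an isolated pair x, y of inner vertices the equations read v y = (deg x - 1) v x and v x = (deg y - 1) v y.
      inner-pair-degrees : ∀ {x y} → Inner x → Inner y → col x ≡ true → adj G x y ≡ true →
        (∀ j → adj G x j ≡ true → Inner j → j ≡ y) → (∀ j → adj G y j ≡ true → Inner j → j ≡ x) →
        deg G x ≡ 2
      inner-pair-degrees {x} {y} hx hy cx xy only-y only-x
        with deg G x in dx | deg G y in dy | ¬pendant⇒2≤deg (inner-¬pendant hx) | ¬pendant⇒2≤deg (inner-¬pendant hy)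
      ... | suc (suc zero) | _ | _ | _ = refl
      ... | suc zero | _ | s≤s () | _
      ... | suc (suc (suc _)) | suc zero | _ | s≤s ()
      ... | suc (suc (suc d)) | suc (suc e) | _ | _ = ⊥-elim (essential hx cx λ v eig _ → ·-fixed (d + e * suc (suc d)) (v x) (fixed v eig))
        where
        fixed : ∀ v → InEigenspace G 1ℚ v → (suc e * suc (suc d)) · v x ≡ v x
        fixed v eig = trans (sym (·-assocˡ (v x) (suc e) (suc (suc d)))) (trans (·-congʳ (suc e) (sym step₁)) (sym step₂))
          where
          lone : ∀ {z t} → Inner z → (∀ j → adj G z j ≡ true → Inner j → j ≡ t) → ∀ j → adj G z j ≡ true → j ≢ t → v j ≡ 0ℚ
          lone hz only j zj j≢t with quasi-or-inner (inner-nbr hz zj)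
          ... | inj₁ hq = quasi-vanishes eig hq
          ... | inj₂ hj = ⊥-elim (j≢t (only j zj hj))
          step₁ : v y ≡ suc (suc d) · v x
          step₁ = row-single G eig dx xy (lone hx only-y)
          step₂ : v x ≡ suc e · v y
          step₂ = row-single G eig dy (sym-adj xy) (lone hy only-x)

-- The bound by quasi-pendant vertices in a rooted tree

module RootedPendantTree {n : ℕ} (G : Graph n) (tree : IsTree G) (6≤n : 6 ≤ n) (p≡q : p G ≡ q G)
  {ρ : Fin n} (R : Rooted G ρ) where

  open PendantTree G tree 6≤n p≡q
  open Rooted R public

  Child : Fin n → Fin n → Set
  Child x c = c ≢ ρ × par c ≡ x

  child-adj : ∀ {x c} → Child x c → adj G x c ≡ true
  child-adj (c≢ρ , refl) = sym-adj (par-adj c≢ρ)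

  child-depth : ∀ {x c} → Child x c → depth c ≡ suc (depth x)
  child-depth (c≢ρ , refl) = depth-par c≢ρ

  depth-zero : ∀ {x} → depth x ≡ 0 → x ≡ ρ
  depth-zero {x} h with x ≟ ρ
  ... | yes e = e
  ... | no ne = case trans (sym h) (depth-par ne) of λ ()

  nbr-child : ∀ {x y} → adj G x y ≡ true → y ≢ par x → Child x y
  nbr-child xy y≢px with nbr-cases xy
  ... | inj₁ (_ , e) = ⊥-elim (y≢px (sym e))
  ... | inj₂ c = c

  has-child : ∀ {x} → ¬ Pendant x → ∃ (Child x)
  has-child {x} h with countF-other (adj G x) (¬pendant⇒2≤deg h) (par x)
  ... | c , xc , c≢ = c , nbr-child xc c≢

  childless-pendant : ∀ {x} → (∀ c → ¬ Child x c) → Pendant x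
  childless-pendant {x} h with pendant? x
  ... | yes hx = hx
  ... | no hx = ⊥-elim (h _ (proj₂ (has-child hx)))

  inner≢root : Quasi ρ → ∀ {x} → Inner x → x ≢ ρ
  inner≢root hρ hx refl = inner-¬quasi hx hρ

  -- Induction from the leaves upwards, well-founded because depths are bounded by that of a deepest
  -- vertex.
  depth-induction : (P : Fin n → Set) → (∀ x → (∀ y → depth x < depth y → P y) → P x) → ∀ x → P x
  depth-induction P ind x = <-rec (λ k → ∀ x → height x ≡ k → P x)
    (λ k rec x e → ind x λ y x<y → rec (subst (height y <_) e (ℕₚ.∸-monoʳ-< x<y (top y))) y refl) (height x) x refl
    where
    deepest = argmax ρ depth
    top = proj₂ deepest
    height : Fin n → ℕ
    height y = depth (proj₁ deepest) ∸ depth y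

  -- Working upwards from the leaves, an inner vertex is computed from the equation at an inner child,
  -- or vanishes by its own equation if all its neighbours are quasi-pendant; f supplies the remaining values.
  child-bound : Quasi ρ → (f : Fin n → Bool) →
    (∀ i → Inner i → Inner (par i) → (∀ c → Child i c → Quasi c) → ∃ λ c → Child i c × f c ≡ true) →
    ∀ r → MultAtLeast G 1ℚ r → r ≤ countF f
  child-bound hρ f enough = multiplicity-bound G 1ℚ f par forcing
    where
    forcing : ∀ v → InEigenspace G 1ℚ v → (∀ y → f y ≡ true → v (par y) ≡ 0ℚ) → ∀ x → v x ≡ 0ℚ
    forcing v eig given = eigenvector-vanishes eig (depth-induction (λ x → Inner x → v x ≡ 0ℚ) at)
      where
      at : ∀ x → (∀ y → depth x < depth y → Inner y → v y ≡ 0ℚ) → Inner x → v x ≡ 0ℚ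
      at x rec hx with any? (λ c → ¬? (c ≟ ρ) ×-dec (par c ≟ x) ×-dec inner? c)
      ... | yes (c , c≢ρ , pc , hc) = row-determines-nbr G eig (rec c x<c hc) (sym-adj (child-adj ch)) others
        where
        ch : Child x c
        ch = c≢ρ , pc
        x<c : depth x < depth c
        x<c = ℕₚ.≤-reflexive (sym (child-depth ch))
        others : ∀ j → adj G c j ≡ true → j ≢ x → v j ≡ 0ℚ
        others j cj j≢x with quasi-or-inner (inner-nbr hc cj)
        ... | inj₁ hq = quasi-vanishes eig hq
        ... | inj₂ hj = rec j (ℕₚ.<-trans x<c (ℕₚ.≤-reflexive (sym (child-depth (nbr-child cj λ e → j≢x (trans e pc)))))) hj
      ... | no none = own (quasi-or-inner (inner-nbr hx (par-adj (inner≢root hρ hx))))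
        where
        children : ∀ c → Child x c → Quasi c
        children c ch with quasi-or-inner (inner-nbr hx (child-adj ch))
        ... | inj₁ hq = hq
        ... | inj₂ hc = ⊥-elim (none (c , proj₁ ch , proj₂ ch , hc))
        own : Quasi (par x) ⊎ Inner (par x) → v x ≡ 0ℚ
        own (inj₁ hq) = inner-vanishes eig hx isolated
          where
          isolated : ∀ j → adj G x j ≡ true → Inner j → v j ≡ 0ℚ
          isolated j xj hj with j ≟ par x
          ... | yes refl = ⊥-elim (inner-¬quasi hj hq)
          ... | no ne = ⊥-elim (inner-¬quasi hj (children j (nbr-child xj ne)))
        own (inj₂ hi) with enough x hx hi children
        ... | c , (_ , refl) , fc = given c fc

  -- A tree of depth at most 1 is a star, and its centre would have two pendant neighbours, against
  -- `pendant-unique`.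
  deep-vertex : ∃ λ x → 2 ≤ depth x × (∀ y → depth y ≤ depth x)
  deep-vertex with argmax ρ depth
  ... | x , top with 2 ℕ.≤? depth x
  ...   | yes h = x , h , top
  ...   | no h with other-vertex ρ
  ...     | a , a≢ρ with third-vertex ρ a
  ...       | b , b≢ρ , b≢a = ⊥-elim (b≢a (pendant-unique (child-adj (level-one b≢ρ)) (child-adj (level-one a≢ρ))
                (leaf b≢ρ) (leaf a≢ρ)))
    where
    shallow : ∀ y → depth y ≤ 1
    shallow y = ℕₚ.≤-trans (top y) (ℕ.s≤s⁻¹ (ℕₚ.≰⇒> h))
    level-one : ∀ {y} → y ≢ ρ → Child ρ y
    level-one {y} ne = ne , depth-zero (ℕₚ.n≤0⇒n≡0 (ℕ.s≤s⁻¹ (subst (_≤ 1) (depth-par ne) (shallow y))))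
    leaf : ∀ {y} → y ≢ ρ → Pendant y
    leaf {y} ne = childless-pendant λ c ch → case subst (_≤ 1) (trans (child-depth ch) (cong suc (depth-par ne))) (shallow c) of λ { (s≤s ()) }

  -- The bottom of the tree: `u` will be a deepest leaf, `w` its parent and `z` its grandparent.
  -- `z-class` lists the two reasons why `w` can be left out of the count: a quasi-pendant `z` has
  -- value zero anyway, and an inner `z` has another quasi-pendant child to be counted for it.
  record End : Set where
    field
      u w z   : Fin n
      u-pend  : Pendant u
      wu      : adj G w u ≡ true
      w≢ρ     : w ≢ ρ
      par-w   : par w ≡ z
      deg-w   : deg G w ≡ 2
      deg-z   : 3 ≤ deg G z
      z-class : Quasi z ⊎ (Inner z × (∃ λ y → Child z y × y ≢ w × Quasi y))

    w-quasi : Quasi w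
    w-quasi = quasi-intro wu u-pend

    w-child : Child z w
    w-child = w≢ρ , par-w

  module _ (noP₃ : ¬ HasPendantP3 G) where

    end : End
    end with deep-vertex
    ... | u , 2≤du , top = record
      { u = u ; w = w ; z = z ; u-pend = u-pend ; wu = wu ; w≢ρ = w≢ρ ; par-w = refl
      ; deg-w = deg-w ; deg-z = deg-z ; z-class = z-class }
      where
      w = par u
      z = par w
      u≢ρ : u ≢ ρ
      u≢ρ e = case subst (2 ≤_) (trans (cong depth e) depth-root) 2≤du of λ ()
      du : depth u ≡ suc (depth w)
      du = depth-par u≢ρ
      w≢ρ : w ≢ ρ
      w≢ρ e = case subst (2 ≤_) (trans du (cong suc (trans (cong depth e) depth-root))) 2≤du of λ { (s≤s ()) }
      dw : depth w ≡ suc (depth z)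
      dw = depth-par w≢ρ
      bottom : ∀ {x} → depth x ≡ depth u → Pendant x
      bottom e = childless-pendant λ c ch → ℕₚ.1+n≰n (subst (_≤ depth u) (trans (child-depth ch) (cong suc e)) (top c))
      u-pend : Pendant u
      u-pend = bottom refl
      wu : adj G w u ≡ true
      wu = sym-adj (par-adj u≢ρ)
      wz : adj G w z ≡ true
      wz = par-adj w≢ρ
      u≢z : u ≢ z
      u≢z e = ℕₚ.m≢1+n+m (depth z) {1} (trans (cong depth (sym e)) (trans du (cong suc dw)))
      -- A child of `w` lies at the greatest depth and is therefore pendant, and `w` has only one
      -- pendant neighbour.
      w-nbrs : ∀ {y} → adj G w y ≡ true → y ≢ z → y ≡ u
      w-nbrs wy y≢z = pendant-unique wy wu (bottom (trans (child-depth (nbr-child wy y≢z)) (sym du))) u-pend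
      deg-w : deg G w ≡ 2
      deg-w with 3 ℕ.≤? deg G w
      ... | no h = ℕₚ.≤-antisym (ℕ.s≤s⁻¹ (ℕₚ.≰⇒> h)) (¬pendant⇒2≤deg (two-nbrs⇒¬pendant wu wz u≢z))
      ... | yes h with countF-third (adj G w) h u z
      ...   | y , wy , y≢u , y≢z = ⊥-elim (y≢u (w-nbrs wy y≢z))
      z-nonpendant : ¬ Pendant z
      z-nonpendant hz = u≢z (pendant-unique wu wz u-pend hz)
      deg-z : 3 ≤ deg G z
      deg-z with 3 ℕ.≤? deg G z
      ... | yes h = h
      -- With degree 2 at `z`, the vertices `z`, `w`, `u` form a pendant path. The attaching
      -- position accepts any neighbour of `z`, and `w` is one.
      ... | no h = ⊥-elim (noP₃ (z , w , u , w , wz , sym-adj wz , wu ,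
        ℕₚ.≤-antisym (ℕ.s≤s⁻¹ (ℕₚ.≰⇒> h)) (¬pendant⇒2≤deg z-nonpendant) , deg-w , pendant-deg u-pend))
      z-class : Quasi z ⊎ (Inner z × (∃ λ y → Child z y × y ≢ w × Quasi y))
      z-class with quasi? z
      ... | yes hz = inj₁ hz
      ... | no hz with countF-third (adj G z) deg-z w (par z)
      ...   | y , zy , y≢w , y≢pz = inj₂ (inner-intro z-nonpendant hz , y , ych , y≢w , y-quasi)
        where
        ych : Child z y
        ych = nbr-child zy y≢pz
        y-nonpendant : ¬ Pendant y
        y-nonpendant hy = hz (quasi-intro zy hy)
        y-quasi : Quasi y
        y-quasi with has-child y-nonpendant
        -- `y` is a sibling of `w`, so its children are as deep as `u` and hence pendant.
        ... | c , ch = quasi-intro (child-adj ch) (bottom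
          (trans (child-depth ch) (trans (cong suc (trans (child-depth ych) (sym dw))) (sym du))))

-- The trees T_k

totalSize : {m : ℕ} → (Fin m → ℕ) → ℕ
totalSize {zero} size = 0
totalSize {suc m} size = size fzero + totalSize (size ∘ fsuc)

label : {m : ℕ} (size : Fin m → ℕ) → Σ (Fin m) (Fin ∘ size) → ℕ
label size (fzero , i) = toℕ i
label size (fsuc j , i) = size fzero + label (size ∘ fsuc) (j , i)

label-< : {m : ℕ} (size : Fin m → ℕ) (c : Σ (Fin m) (Fin ∘ size)) → label size c < totalSize size
label-< size (fzero , i) = ℕₚ.≤-trans (toℕ<n i) (ℕₚ.m≤m+n _ _)
label-< size (fsuc j , i) = subst (_≤ totalSize size) (ℕₚ.+-suc (size fzero) _)
  (ℕₚ.+-monoʳ-≤ (size fzero) (label-< (size ∘ fsuc) (j , i)))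

label-injective : {m : ℕ} (size : Fin m → ℕ) (c d : Σ (Fin m) (Fin ∘ size)) →
  label size c ≡ label size d → c ≡ d
label-injective size (fzero , i) (fzero , j) e = cong (fzero ,_) (toℕ-injective e)
label-injective size (fzero , i) (fsuc d , j) e = ⊥-elim (ℕₚ.<⇒≱ (toℕ<n i) (subst (size fzero ≤_) (sym e) (ℕₚ.m≤m+n _ _)))
label-injective size (fsuc c , i) (fzero , j) e = ⊥-elim (ℕₚ.<⇒≱ (toℕ<n j) (subst (size fzero ≤_) e (ℕₚ.m≤m+n _ _)))
label-injective size (fsuc c , i) (fsuc d , j) e =
  cong (λ (b , l) → fsuc b , l) (label-injective (size ∘ fsuc) (c , i) (d , j) (ℕₚ.+-cancelˡ-≡ (size fzero) _ _ e))

label-surjective : {m : ℕ} (size : Fin m → ℕ) (l : ℕ) → l < totalSize size → ∃ λ c → label size c ≡ l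
label-surjective {suc m} size l l< with l ℕ.<? size fzero
... | yes h = (fzero , fromℕ< h) , toℕ-fromℕ< h
... | no h with label-surjective (size ∘ fsuc) (l ∸ size fzero) (ℕₚ.+-cancelˡ-< (size fzero) _ _ (subst (_< totalSize size) (sym (ℕₚ.m+[n∸m]≡n (ℕₚ.≮⇒≥ h))) l<))
...   | (j , i) , e = (fsuc j , i) , trans (cong (size fzero +_) e) (ℕₚ.m+[n∸m]≡n (ℕₚ.≮⇒≥ h))

size : ℕ → Fin 8 → ℕ
size k 0F = suc k
size k 1F = suc k
size k 2F = k
size k 3F = k
size k _  = 1

-- Adjacency in `Tk` is Boolean arithmetic on labels; a block together with a position in it gives
-- names of vertices that can be matched on.
Code : ℕ → Set
Code k = Σ (Fin 8) (Fin ∘ size k)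

-- The blocks follow the labelling of Tk: c i, the pendant neighbour of c i, a i, b i, and x₁, x₂, y₁, y₂.
pattern C i = 0F , i
pattern P i = 1F , i
pattern A i = 2F , i
pattern B i = 3F , i
pattern X₁ = 4F , fzero
pattern X₂ = 5F , fzero
pattern Y₁ = 6F , fzero
pattern Y₂ = 7F , fzero

-- One constructor for each clause of `edgeT`, in the same order and orientation; this is why `c-b`
-- starts at the `C` vertex.
data Edge {k : ℕ} : Code k → Code k → Set where
  c-p : (i : Fin (suc k)) → Edge (C i) (P i)
  c-a : (i : Fin k) → Edge (C (inject₁ i)) (A i)
  a-b : (i : Fin k) → Edge (A i) (B i)
  c-b : (i : Fin k) → Edge (C (fsuc i)) (B i)
  c-x : Edge (C fzero) X₁
  x-x : Edge X₁ X₂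
  c-y : Edge (C (fromℕ k)) Y₁
  y-y : Edge Y₁ Y₂

Adjacent : {k : ℕ} → Code k → Code k → Set
Adjacent c d = Edge c d ⊎ Edge d c

edge-irreflexive : {k : ℕ} {c d : Code k} → Edge c d → c ≢ d
edge-irreflexive (c-p i) ()
edge-irreflexive (c-a i) ()
edge-irreflexive (a-b i) ()
edge-irreflexive (c-b i) ()
edge-irreflexive c-x ()
edge-irreflexive x-x ()
edge-irreflexive c-y ()
edge-irreflexive y-y ()

-- Decoding the Boolean adjacency of `Tk`

∨-true : {a b : Bool} → a ∨ b ≡ true → a ≡ true ⊎ b ≡ true
∨-true {true} _ = inj₁ refl
∨-true {false} h = inj₂ h

∨-introˡ : {a b : Bool} → a ≡ true → a ∨ b ≡ true
∨-introˡ refl = refl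

-- The singleton case avoids a trailing `false`, so that `disjunction (clauses u v)` is
-- `edgeT k u v` by computation.
disjunction : List Bool → Bool
disjunction [] = false
disjunction (b ∷ []) = b
disjunction (b ∷ c ∷ bs) = b ∨ disjunction (c ∷ bs)

disjunction-intro : (bs : List Bool) → Any (_≡ true) bs → disjunction bs ≡ true
disjunction-intro (b ∷ []) (here h) = h
disjunction-intro (b ∷ c ∷ bs) (here h) = ∨-introˡ h
disjunction-intro (b ∷ c ∷ bs) (there h) with b
... | true = refl
... | false = disjunction-intro (c ∷ bs) h

disjunction-elim : (bs : List Bool) → disjunction bs ≡ true → Any (_≡ true) bs
disjunction-elim (b ∷ []) h = here h
disjunction-elim (b ∷ bs@(_ ∷ _)) h = Sum.[ here , (λ hbs → there (disjunction-elim bs hbs)) ] (∨-true {b} h)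

T⇒true : {b : Bool} → T b → b ≡ true
T⇒true {true} _ = refl

true⇒T : {b : Bool} → b ≡ true → T b
true⇒T refl = _

≡ᵇ-true : ∀ {m n} → m ≡ n → (m ≡ᵇ n) ≡ true
≡ᵇ-true {m} {n} e = T⇒true (ℕₚ.≡⇒≡ᵇ m n e)

true-≡ᵇ : ∀ {m n} → (m ≡ᵇ n) ≡ true → m ≡ n
true-≡ᵇ {m} {n} h = ℕₚ.≡ᵇ⇒≡ m n (true⇒T h)

≤ᵇ-true : ∀ {m n} → m ≤ n → (m ≤ᵇ n) ≡ true
≤ᵇ-true h = T⇒true (ℕₚ.≤⇒≤ᵇ h)

true-≤ᵇ : ∀ {m n} → (m ≤ᵇ n) ≡ true → m ≤ n
true-≤ᵇ {m} {n} h = ℕₚ.≤ᵇ⇒≤ m n (true⇒T h)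

<ᵇ-true : ∀ {m n} → m < n → (m <ᵇ n) ≡ true
<ᵇ-true h = T⇒true (ℕₚ.<⇒<ᵇ h)

true-<ᵇ : ∀ {m n} → (m <ᵇ n) ≡ true → m < n
true-<ᵇ {m} {n} h = ℕₚ.<ᵇ⇒< m n (true⇒T h)

bool-ext : {a b : Bool} → (a ≡ true → b ≡ true) → (b ≡ true → a ≡ true) → a ≡ b
bool-ext {true} f _ = sym (f refl)
bool-ext {false} {true} _ g = g refl
bool-ext {false} {false} _ _ = refl

module Labels (k : ℕ) where

  lab : Code k → ℕ
  lab = label (size k)

  eq-p : ∀ k u → suc k + u ≡ u + k + 1
  eq-p = solve-∀

  eq-a : ∀ k u → suc k + (suc k + u) ≡ u + 2 * k + 2
  eq-a = solve-∀

  eq-a′ : ∀ k u → suc k + (suc k + u) ≡ (2 * k + 2) + u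
  eq-a′ = solve-∀

  eq-a″ : ∀ k u → suc (suc k + (suc k + u)) ≡ (2 * k + 2) + suc u
  eq-a″ = solve-∀

  eq-3k : ∀ k → 3 * k + 2 ≡ (2 * k + 2) + k
  eq-3k = solve-∀

  eq-ab : ∀ k u → suc k + (suc k + (k + u)) ≡ suc k + (suc k + u) + k
  eq-ab = solve-∀

  eq-b : ∀ k u → suc k + (suc k + (k + u)) ≡ suc u + 3 * k + 1
  eq-b = solve-∀

  eq-x₁ : ∀ k → suc k + (suc k + (k + (k + 0))) ≡ 4 * k + 2
  eq-x₁ = solve-∀

  eq-x₂ : ∀ k → suc k + (suc k + (k + (k + 1))) ≡ 4 * k + 3
  eq-x₂ = solve-∀

  eq-y₁ : ∀ k → suc k + (suc k + (k + (k + 2))) ≡ 4 * k + 4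
  eq-y₁ = solve-∀

  eq-y₂ : ∀ k → suc k + (suc k + (k + (k + 3))) ≡ 4 * k + 5
  eq-y₂ = solve-∀

  eq-total : ∀ k → suc k + (suc k + (k + (k + 4))) ≡ 4 * k + 6
  eq-total = solve-∀

  Decoded : ℕ → ℕ → Set
  Decoded u v = ∃₂ λ c d → lab c ≡ u × lab d ≡ v × Edge c d

  clauses : ℕ → ℕ → List Bool
  clauses u v =
    ((u ≤ᵇ k) ∧ (v == u + k + 1)) ∷
    ((u <ᵇ k) ∧ (v == u + 2 * k + 2)) ∷
    (((2 * k + 2) ≤ᵇ u) ∧ (u <ᵇ (3 * k + 2)) ∧ (v == u + k)) ∷
    ((1 ≤ᵇ u) ∧ (u ≤ᵇ k) ∧ (v == u + 3 * k + 1)) ∷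
    ((u == 0) ∧ (v == 4 * k + 2)) ∷
    ((u == 4 * k + 2) ∧ (v == 4 * k + 3)) ∷
    ((u == k) ∧ (v == 4 * k + 4)) ∷
    ((u == 4 * k + 4) ∧ (v == 4 * k + 5)) ∷ []

  ∧-≡ᵇ : ∀ a {v w} → a ∧ (v ≡ᵇ w) ≡ true → w ≡ v
  ∧-≡ᵇ a {v} {w} h = sym (true-≡ᵇ {v} {w} (proj₂ (∧-true {a} h)))

  ≡ᵇ-∧ : ∀ {u w} b → (u ≡ᵇ w) ∧ b ≡ true → w ≡ u
  ≡ᵇ-∧ {u} {w} b h = sym (true-≡ᵇ {u} {w} (proj₁ (∧-true {u ≡ᵇ w} h)))

  clause-decode : ∀ u v → Any (_≡ true) (clauses u v) → Decoded u v
  clause-decode u v (here h) = C i , P i , iu , trans (cong (suc k +_) iu) (trans (eq-p k u) (∧-≡ᵇ (u ≤ᵇ k) h)) , c-p i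
    where
    u<sk = s≤s (true-≤ᵇ {u} {k} (proj₁ (∧-true {u ≤ᵇ k} h)))
    i = fromℕ< u<sk
    iu = toℕ-fromℕ< u<sk
  clause-decode u v (there (here h)) = C (inject₁ i) , A i , trans (toℕ-inject₁ i) iu ,
      trans (cong (λ x → suc k + (suc k + x)) iu) (trans (eq-a k u) (∧-≡ᵇ (u <ᵇ k) h)) , c-a i
    where
    u<k = true-<ᵇ {u} {k} (proj₁ (∧-true {u <ᵇ k} h))
    i = fromℕ< u<k
    iu = toℕ-fromℕ< u<k
  clause-decode u v (there (there (here h))) = A i , B i , au ,
      trans (eq-ab k (toℕ i)) (trans (cong (_+ k) au) (∧-≡ᵇ (u <ᵇ 3 * k + 2) (proj₂ h′))) , a-b i
    where
    h′ = ∧-true {2 * k + 2 ≤ᵇ u} h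
    d = u ∸ (2 * k + 2)
    ud : (2 * k + 2) + d ≡ u
    ud = ℕₚ.m+[n∸m]≡n (true-≤ᵇ {2 * k + 2} {u} (proj₁ h′))
    d<k : d < k
    d<k = ℕₚ.+-cancelˡ-< (2 * k + 2) d k (subst₂ _<_ (sym ud) (eq-3k k)
      (true-<ᵇ {u} {3 * k + 2} (proj₁ (∧-true {u <ᵇ 3 * k + 2} (proj₂ h′)))))
    i = fromℕ< d<k
    au : suc k + (suc k + toℕ i) ≡ u
    au = trans (eq-a′ k (toℕ i)) (trans (cong ((2 * k + 2) +_) (toℕ-fromℕ< d<k)) ud)
  clause-decode (suc u) v (there (there (there (here h)))) = C (fsuc i) , B i , cong suc iu ,
      trans (eq-b k (toℕ i)) (trans (cong (λ x → suc x + 3 * k + 1) iu) (∧-≡ᵇ (suc u ≤ᵇ k) h)) , c-b i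
    where
    u<k = true-≤ᵇ {suc u} {k} (proj₁ (∧-true {suc u ≤ᵇ k} h))
    i = fromℕ< u<k
    iu = toℕ-fromℕ< u<k
  clause-decode u v (there (there (there (there (here h))))) =
    C fzero , X₁ , ≡ᵇ-∧ {u} {0} _ h , trans (eq-x₁ k) (∧-≡ᵇ (u ≡ᵇ 0) h) , c-x
  clause-decode u v (there (there (there (there (there (here h)))))) =
    X₁ , X₂ , trans (eq-x₁ k) (≡ᵇ-∧ {u} {4 * k + 2} _ h) , trans (eq-x₂ k) (∧-≡ᵇ (u ≡ᵇ 4 * k + 2) h) , x-x
  clause-decode u v (there (there (there (there (there (there (here h))))))) =
    C (fromℕ k) , Y₁ , trans (toℕ-fromℕ k) (≡ᵇ-∧ {u} {k} _ h) , trans (eq-y₁ k) (∧-≡ᵇ (u ≡ᵇ k) h) , c-y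
  clause-decode u v (there (there (there (there (there (there (there (here h)))))))) =
    Y₁ , Y₂ , trans (eq-y₁ k) (≡ᵇ-∧ {u} {4 * k + 4} _ h) , trans (eq-y₂ k) (∧-≡ᵇ (u ≡ᵇ 4 * k + 4) h) , y-y

  edge-clause : ∀ {c d} → Edge c d → Any (_≡ true) (clauses (lab c) (lab d))
  edge-clause (c-p i) = here (∧-intro (≤ᵇ-true (ℕ.s≤s⁻¹ (toℕ<n i))) (≡ᵇ-true (eq-p k (toℕ i))))
  edge-clause (c-a i) rewrite toℕ-inject₁ i = there (here
    (∧-intro (<ᵇ-true (toℕ<n i)) (≡ᵇ-true (eq-a k (toℕ i)))))
  edge-clause (a-b i) = there (there (here (∧-intro
    (≤ᵇ-true (subst (2 * k + 2 ≤_) (sym (eq-a′ k (toℕ i))) (ℕₚ.m≤m+n _ _))) (∧-intro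
    (<ᵇ-true (subst₂ _≤_ (sym (eq-a″ k (toℕ i))) (sym (eq-3k k)) (ℕₚ.+-monoʳ-≤ (2 * k + 2) (toℕ<n i))))
    (≡ᵇ-true (eq-ab k (toℕ i)))))))
  edge-clause (c-b i) = there (there (there (here
    (∧-intro (≤ᵇ-true {suc (toℕ i)} (toℕ<n i)) (≡ᵇ-true (eq-b k (toℕ i)))))))
  edge-clause c-x = there (there (there (there (here (≡ᵇ-true (eq-x₁ k))))))
  edge-clause x-x = there (there (there (there (there (here
    (∧-intro (≡ᵇ-true (eq-x₁ k)) (≡ᵇ-true (eq-x₂ k))))))))
  edge-clause c-y = there (there (there (there (there (there (here
    (∧-intro (≡ᵇ-true (toℕ-fromℕ k)) (≡ᵇ-true (eq-y₁ k)))))))))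
  edge-clause y-y = there (there (there (there (there (there (there (here
    (∧-intro (≡ᵇ-true (eq-y₁ k)) (≡ᵇ-true (eq-y₂ k))))))))))

  edge-decode : ∀ u v → edgeT k u v ≡ true → Decoded u v
  edge-decode u v h = clause-decode u v (disjunction-elim (clauses u v) h)

  edge-encode : ∀ {c d} → Edge c d → edgeT k (lab c) (lab d) ≡ true
  edge-encode {c} {d} e = disjunction-intro (clauses (lab c) (lab d)) (edge-clause e)

-- A copy of `Tk k` inside `G`, named by codes. The structure of extremal trees is delivered in this
-- form, and the eigenvectors are written in it; two realisations with the same `k` give an
-- isomorphism.
record Realises {n : ℕ} (G : Graph n) (k : ℕ) : Set where
  field
    vertex     : Code k → Fin n
    injective  : ∀ {c d} → vertex c ≡ vertex d → c ≡ d
    surjective : ∀ x → ∃ λ c → vertex c ≡ x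
    adj⇒edge   : ∀ {c d} → adj G (vertex c) (vertex d) ≡ true → Adjacent c d
    edge⇒adj   : ∀ {c d} → Edge c d → adj G (vertex c) (vertex d) ≡ true

  adjacent⇒adj : ∀ {c d} → Adjacent c d → adj G (vertex c) (vertex d) ≡ true
  adjacent⇒adj (inj₁ e) = edge⇒adj e
  adjacent⇒adj (inj₂ e) = adj-symmetric G (edge⇒adj e)

  code : Fin n → Code k
  code x = proj₁ (surjective x)

  vertex-code : ∀ x → vertex (code x) ≡ x
  vertex-code x = proj₂ (surjective x)

  code-vertex : ∀ c → code (vertex c) ≡ c
  code-vertex c = injective (vertex-code (vertex c))

realisations-isomorphic : {m n k : ℕ} {G : Graph m} {H : Graph n} → Realises G k → Realises H k → G ≅ H
realisations-isomorphic {G = G} {H} RG RH = mk↔ₛ′ (λ x → RH.vertex (RG.code x)) (λ y → RG.vertex (RH.code y))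
    (λ y → trans (cong RH.vertex (RG.code-vertex (RH.code y))) (RH.vertex-code y))
    (λ x → trans (cong RG.vertex (RH.code-vertex (RG.code x))) (RG.vertex-code x)) ,
  λ i j → bool-ext
    (λ h → subst₂ (λ x y → adj G x y ≡ true) (RG.vertex-code i) (RG.vertex-code j) (RG.adjacent⇒adj (RH.adj⇒edge h)))
    (λ h → RH.adjacent⇒adj (RG.adj⇒edge (subst₂ (λ x y → adj G x y ≡ true) (sym (RG.vertex-code i)) (sym (RG.vertex-code j)) h)))
  where
  module RG = Realises RG
  module RH = Realises RH

realises-Tk : (k : ℕ) → Realises (Tk k) k
realises-Tk k = record
  { vertex = enc ; injective = enc-injective ; surjective = enc-surjective ; adj⇒edge = adj⇒edge ; edge⇒adj = edge⇒adj }
  where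
  open Labels k
  lab< : ∀ c → lab c < 4 * k + 6
  lab< c = subst (lab c <_) (eq-total k) (label-< (size k) c)
  enc : Code k → Fin (4 * k + 6)
  enc c = fromℕ< (lab< c)
  toℕ-enc : ∀ c → toℕ (enc c) ≡ lab c
  toℕ-enc c = toℕ-fromℕ< (lab< c)
  enc-injective : ∀ {c d} → enc c ≡ enc d → c ≡ d
  enc-injective {c} {d} e = label-injective (size k) c d (trans (sym (toℕ-enc c)) (trans (cong toℕ e) (toℕ-enc d)))
  enc-surjective : ∀ x → ∃ λ c → enc c ≡ x
  enc-surjective x =
    let c , e = label-surjective (size k) (toℕ x) (subst (toℕ x <_) (sym (eq-total k)) (toℕ<n x))
    in c , toℕ-injective (trans (toℕ-enc c) e)
  decode : ∀ c d → edgeT k (toℕ (enc c)) (toℕ (enc d)) ≡ true → Edge c d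
  decode c d h = let c′ , d′ , ec , ed , e = edge-decode (toℕ (enc c)) (toℕ (enc d)) h in subst₂ Edge (label-injective (size k) c′ c (trans ec (toℕ-enc c))) (label-injective (size k) d′ d (trans ed (toℕ-enc d))) e
  adj⇒edge : ∀ {c d} → adjT k (enc c) (enc d) ≡ true → Adjacent c d
  adj⇒edge {c} {d} h = Sum.map (decode c d) (decode d c) (∨-true {edgeT k (toℕ (enc c)) (toℕ (enc d))} (proj₁ (∧-true {edgeT k (toℕ (enc c)) (toℕ (enc d)) ∨ edgeT k (toℕ (enc d)) (toℕ (enc c))} h)))
  edge⇒adj : ∀ {c d} → Edge c d → adjT k (enc c) (enc d) ≡ true
  edge⇒adj {c} {d} e = ∧-intro (∨-introˡ (subst₂ (λ u v → edgeT k u v ≡ true) (sym (toℕ-enc c)) (sym (toℕ-enc d)) (edge-encode e)))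
    (≢⇒not-does λ eq → edge-irreflexive e (enc-injective eq))

realises-isomorphic : {m n k : ℕ} {G : Graph m} {H : Graph n} → G ≅ H → Realises H k → Realises G k
realises-isomorphic {k = k} {G} {H} (σ , σ-adj) RH = record
  { vertex = vertex
  ; injective = λ {c} {d} e → RH.injective (trans (sym (to-vertex c)) (trans (cong (Inverse.to σ) e) (to-vertex d)))
  ; surjective = λ x → RH.code (Inverse.to σ x) , trans (cong (Inverse.from σ) (RH.vertex-code (Inverse.to σ x))) (Inverse.strictlyInverseʳ σ x)
  ; adj⇒edge = λ {c} {d} h → RH.adj⇒edge (trans (adj-vertex c d) h)
  ; edge⇒adj = λ {c} {d} e → trans (sym (adj-vertex c d)) (RH.edge⇒adj e)
  }
  where
  module RH = Realises RH
  vertex : Code k → Fin _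
  vertex c = Inverse.from σ (RH.vertex c)
  to-vertex : ∀ c → Inverse.to σ (vertex c) ≡ RH.vertex c
  to-vertex c = Inverse.strictlyInverseˡ σ (RH.vertex c)
  adj-vertex : ∀ c d → adj H (RH.vertex c) (RH.vertex d) ≡ adj G (vertex c) (vertex d)
  adj-vertex c d = trans (sym (cong₂ (adj H) (to-vertex c) (to-vertex d))) (σ-adj (vertex c) (vertex d))

-- Eigenvectors of `Tk`

χ : {n : ℕ} → Fin n → Fin n → ℚ
χ a i = if does (i ≟ a) then 1ℚ else 0ℚ

χ-self : {n : ℕ} (a : Fin n) → χ a a ≡ 1ℚ
χ-self a with a ≟ a
... | yes _ = refl
... | no ne = ⊥-elim (ne refl)

χ-other : {n : ℕ} {a i : Fin n} → i ≢ a → χ a i ≡ 0ℚ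
χ-other {a = a} {i} ne with i ≟ a
... | yes e = ⊥-elim (ne e)
... | no _ = refl

countF-empty : {n : ℕ} (f : Fin n → Bool) → (∀ i → f i ≢ true) → countF f ≡ 0
countF-empty f h with countF f in cf
... | zero = refl
... | suc m with countF-witness f (subst (1 ≤_) (sym cf) (s≤s z≤n))
...   | a , fa = ⊥-elim (h a fa)

deg-one : {n : ℕ} (G : Graph n) {x y : Fin n} → adj G x y ≡ true →
  (∀ i → adj G x i ≡ true → i ≡ y) → deg G x ≡ 1
deg-one G {x} {y} xy only = trans (countF-without (adj G x) y xy) (cong suc (countF-empty (without (adj G x) y)
  λ j h → without-≢ (adj G x) h (only j (without-⊆ (adj G x) h))))

deg-two : {n : ℕ} (G : Graph n) {x y z : Fin n} → y ≢ z → adj G x y ≡ true → adj G x z ≡ true →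
  (∀ i → adj G x i ≡ true → i ≡ y ⊎ i ≡ z) → deg G x ≡ 2
deg-two G {x} {y} {z} y≢z xy xz only = trans (countF-without (adj G x) y xy) (cong suc
  (trans (countF-without (without (adj G x) y) z (without-intro (adj G x) xz (y≢z ∘ sym)))
    (cong suc (countF-empty (without (without (adj G x) y) z) none))))
  where
  none : ∀ j → without (without (adj G x) y) z j ≢ true
  none j h with only j (without-⊆ (adj G x) (without-⊆ (without (adj G x) y) h))
  ... | inj₁ e = without-≢ (adj G x) (without-⊆ (without (adj G x) y) h) e
  ... | inj₂ e = without-≢ (without (adj G x) y) h e

-- This is the Laplacian applied to the indicator of a pendant vertex. The eigenvectors below are
-- supported on vertices of degree 1 and 2, so working with columns avoids computing degrees at the
-- `C` vertices.
laplacian-column₁ : {n : ℕ} (G : Graph n) {x y : Fin n} → adj G x y ≡ true →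
  (∀ i → adj G x i ≡ true → i ≡ y) → ∀ i → laplacian G i x ≡ χ x i +ℚ (-ℚ χ y i)
laplacian-column₁ G {x} {y} xy only i with i ≟ x | i ≟ y
... | yes refl | yes e = ⊥-elim (adj-irreflexive G xy e)
... | yes refl | no _ rewrite deg-one G xy only = refl
... | no _ | yes refl rewrite adj-symmetric G xy = refl
... | no _ | no i≢y rewrite Boolₚ.¬-not (λ h → i≢y (only i (adj-symmetric G {i} {x} h))) = refl

laplacian-column₂ : {n : ℕ} (G : Graph n) {x y z : Fin n} → y ≢ z → adj G x y ≡ true → adj G x z ≡ true →
  (∀ i → adj G x i ≡ true → i ≡ y ⊎ i ≡ z) →
  ∀ i → laplacian G i x ≡ (χ x i +ℚ χ x i) +ℚ ((-ℚ χ y i) +ℚ (-ℚ χ z i))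
laplacian-column₂ G {x} {y} {z} y≢z xy xz only i with i ≟ x | i ≟ y | i ≟ z
... | yes refl | yes e | _ = ⊥-elim (adj-irreflexive G xy e)
... | yes refl | no _ | yes e = ⊥-elim (adj-irreflexive G xz e)
... | yes refl | no _ | no _ rewrite deg-two G y≢z xy xz only = refl
... | no _ | yes refl | yes e = ⊥-elim (y≢z e)
... | no _ | yes refl | no _ rewrite adj-symmetric G xy = refl
... | no _ | no _ | yes refl rewrite adj-symmetric G xz = refl
... | no _ | no i≢y | no i≢z rewrite Boolₚ.¬-not (λ h → Sum.[ i≢y , i≢z ] (only i (adj-symmetric G {i} {x} h))) = refl

laplacian-χ : {n : ℕ} (G : Graph n) (c : ℚ) (a i : Fin n) →
  sumℚ (λ j → laplacian G i j *ℚ (c *ℚ χ a j)) ≡ c *ℚ laplacian G i a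
laplacian-χ G c a i = trans (sumℚ-single a λ j j≢a →
    trans (cong (λ x → laplacian G i j *ℚ (c *ℚ x)) (χ-other j≢a)) (solve 2 (λ l c → l :* (c :* con 0ℚ) := con 0ℚ) refl (laplacian G i j) c))
  (trans (cong (λ x → laplacian G i a *ℚ (c *ℚ x)) (χ-self a)) (solve 2 (λ l c → l :* (c :* con 1ℚ) := c :* l) refl (laplacian G i a) c))
  where open +-*-Solver

module Eigenvectors {n k : ℕ} (G : Graph n) (real : Realises G k) where

  open Realises real

  -- The value is 1 on the inner pair a, b and -1 on the pendant neighbours of the two `C` vertices
  -- beside it, which balances the equations at those two vertices. The factors `1ℚ` give all four
  -- terms the shape expected by `laplacian-χ`.
  vec : Fin k → Fin n → ℚ
  vec s j = (1ℚ *ℚ χ (vertex (A s)) j +ℚ 1ℚ *ℚ χ (vertex (B s)) j) +ℚ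
    ((-ℚ 1ℚ) *ℚ χ (vertex (P (inject₁ s))) j +ℚ (-ℚ 1ℚ) *ℚ χ (vertex (P (fsuc s))) j)

  nbrs : ∀ {d} {Q : Fin n → Set} → (∀ c → Adjacent d c → Q (vertex c)) → ∀ i → adj G (vertex d) i ≡ true → Q i
  nbrs {d} {Q} h i di = subst Q (vertex-code i) (h (code i) (adj⇒edge (subst (λ t → adj G (vertex d) t ≡ true) (sym (vertex-code i)) di)))

  a-nbrs : ∀ s c → Adjacent (A s) c → vertex c ≡ vertex (C (inject₁ s)) ⊎ vertex c ≡ vertex (B s)
  a-nbrs s _ (inj₁ (a-b _)) = inj₂ refl
  a-nbrs s _ (inj₂ (c-a _)) = inj₁ refl

  b-nbrs : ∀ s c → Adjacent (B s) c → vertex c ≡ vertex (C (fsuc s)) ⊎ vertex c ≡ vertex (A s)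
  b-nbrs s _ (inj₂ (a-b _)) = inj₂ refl
  b-nbrs s _ (inj₂ (c-b _)) = inj₁ refl

  p-nbrs : ∀ s c → Adjacent (P s) c → vertex c ≡ vertex (C s)
  p-nbrs s _ (inj₂ (c-p _)) = refl

  vec-eigen : ∀ s → InEigenspace G 1ℚ (vec s)
  vec-eigen s i = begin
    sumℚ (λ j → L j *ℚ vec s j)
      ≡⟨ sumℚ-cong (λ j → solve 5 (λ l a b c d → l :* ((a :+ b) :+ (c :+ d)) := (l :* a :+ l :* b) :+ (l :* c :+ l :* d)) refl
           (L j) (1ℚ *ℚ χ a j) (1ℚ *ℚ χ b j) ((-ℚ 1ℚ) *ℚ χ x j) ((-ℚ 1ℚ) *ℚ χ y j)) ⟩
    sumℚ (λ j → (L j *ℚ (1ℚ *ℚ χ a j) +ℚ L j *ℚ (1ℚ *ℚ χ b j)) +ℚ (L j *ℚ ((-ℚ 1ℚ) *ℚ χ x j) +ℚ L j *ℚ ((-ℚ 1ℚ) *ℚ χ y j)))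
      ≡⟨ sumℚ-+ (λ j → L j *ℚ (1ℚ *ℚ χ a j) +ℚ L j *ℚ (1ℚ *ℚ χ b j)) (λ j → L j *ℚ ((-ℚ 1ℚ) *ℚ χ x j) +ℚ L j *ℚ ((-ℚ 1ℚ) *ℚ χ y j)) ⟩
    sumℚ (λ j → L j *ℚ (1ℚ *ℚ χ a j) +ℚ L j *ℚ (1ℚ *ℚ χ b j)) +ℚ sumℚ (λ j → L j *ℚ ((-ℚ 1ℚ) *ℚ χ x j) +ℚ L j *ℚ ((-ℚ 1ℚ) *ℚ χ y j))
      ≡⟨ cong₂ _+ℚ_
           (trans (sumℚ-+ (λ j → L j *ℚ (1ℚ *ℚ χ a j)) (λ j → L j *ℚ (1ℚ *ℚ χ b j))) (cong₂ _+ℚ_ (laplacian-χ G 1ℚ a i) (laplacian-χ G 1ℚ b i)))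
           (trans (sumℚ-+ (λ j → L j *ℚ ((-ℚ 1ℚ) *ℚ χ x j)) (λ j → L j *ℚ ((-ℚ 1ℚ) *ℚ χ y j))) (cong₂ _+ℚ_ (laplacian-χ G (-ℚ 1ℚ) x i) (laplacian-χ G (-ℚ 1ℚ) y i))) ⟩
    (1ℚ *ℚ L a +ℚ 1ℚ *ℚ L b) +ℚ ((-ℚ 1ℚ) *ℚ L x +ℚ (-ℚ 1ℚ) *ℚ L y)
      ≡⟨ cong₂ _+ℚ_ (cong₂ _+ℚ_ (cong (1ℚ *ℚ_) La) (cong (1ℚ *ℚ_) Lb)) (cong₂ _+ℚ_ (cong ((-ℚ 1ℚ) *ℚ_) Lx) (cong ((-ℚ 1ℚ) *ℚ_) Ly)) ⟩
    (1ℚ *ℚ ((χ a i +ℚ χ a i) +ℚ ((-ℚ χ c i) +ℚ (-ℚ χ b i))) +ℚ 1ℚ *ℚ ((χ b i +ℚ χ b i) +ℚ ((-ℚ χ d i) +ℚ (-ℚ χ a i)))) +ℚ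
    ((-ℚ 1ℚ) *ℚ (χ x i +ℚ (-ℚ χ c i)) +ℚ (-ℚ 1ℚ) *ℚ (χ y i +ℚ (-ℚ χ d i)))
      -- The terms at `c` and `d` cancel between the inner and the pendant columns, and the edge
      -- between `a` and `b` removes one of the two copies of each.
      ≡⟨ solve 6 (λ a b c d x y →
           (con 1ℚ :* ((a :+ a) :+ ((:- c) :+ (:- b))) :+ con 1ℚ :* ((b :+ b) :+ ((:- d) :+ (:- a)))) :+
           ((:- con 1ℚ) :* (x :+ (:- c)) :+ (:- con 1ℚ) :* (y :+ (:- d))) :=
           con 1ℚ :* ((con 1ℚ :* a :+ con 1ℚ :* b) :+ ((:- con 1ℚ) :* x :+ (:- con 1ℚ) :* y))) refl
           (χ a i) (χ b i) (χ c i) (χ d i) (χ x i) (χ y i) ⟩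
    1ℚ *ℚ vec s i ∎
    where
    open ≡-Reasoning
    open +-*-Solver
    L : Fin n → ℚ
    L = laplacian G i
    a b c d x y : Fin n
    a = vertex (A s)
    b = vertex (B s)
    c = vertex (C (inject₁ s))
    d = vertex (C (fsuc s))
    x = vertex (P (inject₁ s))
    y = vertex (P (fsuc s))
    La = laplacian-column₂ G {a} {c} {b} (λ e → case injective e of λ ())
      (adjacent⇒adj (inj₂ (c-a s))) (adjacent⇒adj (inj₁ (a-b s))) (nbrs (a-nbrs s)) i
    Lb = laplacian-column₂ G {b} {d} {a} (λ e → case injective e of λ ())
      (adjacent⇒adj (inj₂ (c-b s))) (adjacent⇒adj (inj₂ (a-b s))) (nbrs (b-nbrs s)) i
    Lx = laplacian-column₁ G {x} {c} (adjacent⇒adj (inj₂ (c-p (inject₁ s)))) (nbrs (p-nbrs (inject₁ s))) i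
    Ly = laplacian-column₁ G {y} {d} (adjacent⇒adj (inj₂ (c-p (fsuc s)))) (nbrs (p-nbrs (fsuc s))) i

  vec-at : ∀ s s′ → vec s′ (vertex (A s)) ≡ χ (vertex (A s′)) (vertex (A s))
  vec-at s s′ = trans (cong₂ (λ b xy → (1ℚ *ℚ χ (vertex (A s′)) v +ℚ 1ℚ *ℚ b) +ℚ xy) (off λ ())
      (cong₂ (λ x y → (-ℚ 1ℚ) *ℚ x +ℚ (-ℚ 1ℚ) *ℚ y) (off λ ()) (off λ ())))
    (solve 1 (λ a → (con 1ℚ :* a :+ con 1ℚ :* con 0ℚ) :+ ((:- con 1ℚ) :* con 0ℚ :+ (:- con 1ℚ) :* con 0ℚ) := a) refl (χ (vertex (A s′)) v))
    where
    open +-*-Solver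
    v = vertex (A s)
    off : ∀ {c} → A s ≢ c → χ (vertex c) v ≡ 0ℚ
    off ne = χ-other λ e → ne (injective e)

  vec-independent : LinIndep vec
  vec-independent c h s = begin
    c s                                          ≡⟨ ℚₚ.*-identityʳ (c s) ⟨
    c s *ℚ 1ℚ                                    ≡⟨ cong (c s *ℚ_) (trans (vec-at s s) (χ-self (vertex (A s)))) ⟨
    c s *ℚ vec s (vertex (A s))                  ≡⟨ sumℚ-single s off ⟨
    sumℚ (λ s′ → c s′ *ℚ vec s′ (vertex (A s)))  ≡⟨ h (vertex (A s)) ⟩
    0ℚ                                           ∎
    where
    open ≡-Reasoning
    off : ∀ s′ → s′ ≢ s → c s′ *ℚ vec s′ (vertex (A s)) ≡ 0ℚ
    off s′ ne = trans (cong (c s′ *ℚ_) (trans (vec-at s s′) (χ-other λ e → ne (case injective e of λ { refl → refl })))) (ℚₚ.*-zeroʳ (c s′))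

  multiplicity : MultAtLeast G 1ℚ k
  multiplicity = vec , vec-independent , vec-eigen

-- The bound and the case of equality

-- Splits an attained sum of bounds into its summands: slack in one of them would have to be paid
-- for by another.
sum-squeezeˡ : ∀ {a a′ b b′} → b ≤ b′ → a′ + b′ ≤ a + b → a′ ≤ a
sum-squeezeˡ {a} {a′} {b} b≤b′ h = ℕₚ.+-cancelʳ-≤ b a′ a (ℕₚ.≤-trans (ℕₚ.+-monoʳ-≤ a′ b≤b′) h)

sum-squeezeʳ : ∀ {a a′ b b′} → a ≤ a′ → a′ + b′ ≤ a + b → b′ ≤ b
sum-squeezeʳ {a} {a′} {b} {b′} a≤a′ h = ℕₚ.+-cancelˡ-≤ a b′ b (ℕₚ.≤-trans (ℕₚ.+-monoˡ-≤ b′ a≤a′) h)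

divide-unique : ∀ {a b} m n → a < 3 → b < 3 → a + m * 3 ≡ b + n * 3 → a ≡ b × m ≡ n
divide-unique {a} {b} zero zero _ _ e = trans (sym (ℕₚ.+-identityʳ a)) (trans e (ℕₚ.+-identityʳ b)) , refl
divide-unique {a} {b} zero (suc n) a<3 _ e = ⊥-elim (ℕₚ.<⇒≱ a<3 (subst (3 ≤_) (sym (trans (sym (ℕₚ.+-identityʳ a)) e))
  (ℕₚ.≤-trans (ℕₚ.m≤m+n 3 (n * 3)) (ℕₚ.m≤n+m _ b))))
divide-unique {a} {b} (suc m) zero _ b<3 e = ⊥-elim (ℕₚ.<⇒≱ b<3 (subst (3 ≤_) (trans e (ℕₚ.+-identityʳ b))
  (ℕₚ.≤-trans (ℕₚ.m≤m+n 3 (m * 3)) (ℕₚ.m≤n+m _ a))))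
divide-unique {a} {b} (suc m) (suc n) a<3 b<3 e =
  case divide-unique m n a<3 b<3 (ℕₚ.+-cancelˡ-≡ 3 _ _ (trans (sym (move a (m * 3))) (trans e (move b (n * 3))))) of
  λ (a≡b , m≡n) → a≡b , cong suc m≡n
  where
  move : ∀ a x → a + (3 + x) ≡ 3 + (a + x)
  move = solve-∀

divide-three : ∀ j → ∃ λ m → (j ≡ m * 3 ⊎ j ≡ 1 + m * 3 ⊎ j ≡ 2 + m * 3)
divide-three 0 = 0 , inj₁ refl
divide-three 1 = 0 , inj₂ (inj₁ refl)
divide-three 2 = 0 , inj₂ (inj₂ refl)
divide-three (suc (suc (suc j))) with divide-three j
... | m , inj₁ e = suc m , inj₁ (cong (3 +_) e)
... | m , inj₂ (inj₁ e) = suc m , inj₂ (inj₁ (cong (3 +_) e))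
... | m , inj₂ (inj₂ e) = suc m , inj₂ (inj₂ (cong (3 +_) e))

thirds-≤ : ∀ m k → m * 3 ≤ 2 + k * 3 → m ≤ k
thirds-≤ zero k _ = z≤n
thirds-≤ (suc m) zero (s≤s (s≤s ()))
thirds-≤ (suc m) (suc k) (s≤s (s≤s (s≤s h))) = s≤s (thirds-≤ m k h)

-- Positions along the spine

module Places (k : ℕ) where

  -- For a non-pendant code, `place` is the depth in the tree rooted at `X₁`, written with base 3,
  -- the period of the pattern. A pendant code shares the place of its neighbour.
  remainder quotient place : Code k → ℕ
  remainder (C _) = 1
  remainder (P _) = 1
  remainder (A _) = 2
  remainder (B _) = 0
  remainder X₁ = 0
  remainder X₂ = 0
  remainder Y₁ = 2
  remainder Y₂ = 2
  quotient (C i) = toℕ i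
  quotient (P i) = toℕ i
  quotient (A i) = toℕ i
  quotient (B i) = suc (toℕ i)
  quotient X₁ = 0
  quotient X₂ = 0
  quotient Y₁ = k
  quotient Y₂ = k
  place c = remainder c + quotient c * 3

  pendantCode : Code k → Bool
  pendantCode (P _) = true
  pendantCode X₂ = true
  pendantCode Y₂ = true
  pendantCode _ = false

  remainder<3 : ∀ c → remainder c < 3
  remainder<3 (C _) = s≤s (s≤s z≤n)
  remainder<3 (P _) = s≤s (s≤s z≤n)
  remainder<3 (A _) = s≤s (s≤s (s≤s z≤n))
  remainder<3 (B _) = s≤s z≤n
  remainder<3 X₁ = s≤s z≤n
  remainder<3 X₂ = s≤s z≤n
  remainder<3 Y₁ = s≤s (s≤s (s≤s z≤n))
  remainder<3 Y₂ = s≤s (s≤s (s≤s z≤n))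

  index-bound : (i : Fin k) → suc (toℕ i) * 3 ≤ k * 3
  index-bound i = ℕₚ.*-monoˡ-≤ 3 (toℕ<n i)

  index-bound′ : (i : Fin (suc k)) → toℕ i * 3 ≤ k * 3
  index-bound′ i = ℕₚ.*-monoˡ-≤ 3 (ℕ.s≤s⁻¹ (toℕ<n i))

  place≤ : ∀ c → place c ≤ 2 + k * 3
  place≤ (C i) = s≤s (ℕₚ.m≤n⇒m≤1+n (index-bound′ i))
  place≤ (P i) = s≤s (ℕₚ.m≤n⇒m≤1+n (index-bound′ i))
  place≤ (A i) = ℕₚ.m≤n⇒m≤1+n (ℕₚ.m≤n⇒m≤1+n (ℕₚ.≤-trans (ℕₚ.n≤1+n _) (index-bound i)))
  place≤ (B i) = ℕₚ.m≤n⇒m≤1+n (ℕₚ.m≤n⇒m≤1+n (index-bound i))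
  place≤ X₁ = z≤n
  place≤ X₂ = z≤n
  place≤ Y₁ = ℕₚ.≤-refl
  place≤ Y₂ = ℕₚ.≤-refl

  -- Remainder and pendancy fix the block with two exceptions at the ends of the spine: remainder 0
  -- means `B` except at quotient 0, and remainder 2 means `A` except at quotient `k`.
  block : Bool → ℕ → ℕ → Fin 8
  block false 0 zero = 4F
  block false 0 (suc _) = 3F
  block false 1 _ = 0F
  block false _ m = if m <ᵇ k then 2F else 6F
  block true 0 _ = 5F
  block true 1 _ = 1F
  block true _ _ = 7F

  block-correct : ∀ c → block (pendantCode c) (remainder c) (quotient c) ≡ proj₁ c
  block-correct (C _) = refl
  block-correct (P _) = refl
  block-correct (A i) rewrite <ᵇ-true (toℕ<n i) = refl
  block-correct (B _) = refl
  block-correct X₁ = refl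
  block-correct X₂ = refl
  block-correct Y₁ rewrite Boolₚ.¬-not {k <ᵇ k} (λ h → ℕₚ.<-irrefl refl (true-<ᵇ {k} {k} h)) = refl
  block-correct Y₂ = refl

  quotient-injective : ∀ c d → proj₁ c ≡ proj₁ d → quotient c ≡ quotient d → c ≡ d
  quotient-injective (C i) (C j) refl e = cong (0F ,_) (toℕ-injective e)
  quotient-injective (P i) (P j) refl e = cong (1F ,_) (toℕ-injective e)
  quotient-injective (A i) (A j) refl e = cong (2F ,_) (toℕ-injective e)
  quotient-injective (B i) (B j) refl e = cong (3F ,_) (toℕ-injective (ℕₚ.suc-injective e))
  quotient-injective X₁ X₁ refl _ = refl
  quotient-injective X₂ X₂ refl _ = refl
  quotient-injective Y₁ Y₁ refl _ = refl
  quotient-injective Y₂ Y₂ refl _ = refl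

  place-injective : ∀ c d → pendantCode c ≡ pendantCode d → place c ≡ place d → c ≡ d
  place-injective c d e e′ with divide-unique (quotient c) (quotient d) (remainder<3 c) (remainder<3 d) e′
  ... | er , eq = quotient-injective c d (trans (sym (block-correct c)) (trans same (block-correct d))) eq
    where
    same : block (pendantCode c) (remainder c) (quotient c) ≡ block (pendantCode d) (remainder d) (quotient d)
    same = trans (cong₂ (λ b m → block b m (quotient c)) e er) (cong (block (pendantCode d) (remainder d)) eq)

  place-surjective : ∀ j → j ≤ 2 + k * 3 → ∃ λ c → pendantCode c ≡ false × place c ≡ j
  place-surjective j h with divide-three j
  ... | zero , inj₁ e = X₁ , refl , sym e
  ... | suc m , inj₁ e = B i , refl , trans (cong (λ x → suc x * 3) (toℕ-fromℕ< m<k)) (sym e)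
    where
    m<k = thirds-≤ (suc m) k (subst (_≤ 2 + k * 3) e h)
    i = fromℕ< m<k
  ... | m , inj₂ (inj₁ e) = C i , refl , trans (cong (λ x → suc (x * 3)) (toℕ-fromℕ< m≤k)) (sym e)
    where
    m≤k : m < suc k
    m≤k = s≤s (thirds-≤ m k (ℕₚ.≤-trans (ℕₚ.n≤1+n _) (subst (_≤ 2 + k * 3) e h)))
    i = fromℕ< m≤k
  ... | m , inj₂ (inj₂ e) with m ℕ.≟ k
  ...   | yes refl = Y₁ , refl , sym e
  ...   | no m≢k = A i , refl , trans (cong (λ x → 2 + x * 3) (toℕ-fromℕ< m<k)) (sym e)
    where
    m<k = ℕₚ.≤∧≢⇒< (thirds-≤ m k (ℕₚ.≤-trans (ℕₚ.m≤n⇒m≤1+n (ℕₚ.n≤1+n _)) (subst (_≤ 2 + k * 3) e h))) m≢k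
    i = fromℕ< m<k

even : ℕ → Bool
even zero = true
even (suc d) = not (even d)

-- The bounds in a tree rooted at one of its ends

module Pruned {n : ℕ} (G : Graph n) (tree : IsTree G) (6≤n : 6 ≤ n) (p≡q : p G ≡ q G)
  (noP₃ : ¬ HasPendantP3 G)
  {ρ₀ : Fin n} (R₀ : Rooted G ρ₀) (end₀ : RootedPendantTree.End G tree 6≤n p≡q R₀)
  (R : Rooted G (RootedPendantTree.End.w end₀)) (end₁ : RootedPendantTree.End G tree 6≤n p≡q R) where

  module T₀ = RootedPendantTree G tree 6≤n p≡q R₀
  module E₀ = T₀.End end₀

  ρ : Fin n
  ρ = E₀.w

  open PendantTree G tree 6≤n p≡q
  open RootedPendantTree G tree 6≤n p≡q R
  module E₁ = End end₁

  ρ-quasi : Quasi ρ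
  ρ-quasi = E₀.w-quasi

  z₀ w₁ z₁ : Fin n
  z₀ = E₀.z
  w₁ = E₁.w
  z₁ = E₁.z

  -- Moving the root to the lower vertex of this edge turns its old parent into a child.
  z₀-child : Child ρ z₀
  z₀-child with nbr-cases (sym-adj (T₀.child-adj E₀.w-child))
  ... | inj₁ (ne , _) = ⊥-elim (ne refl)
  ... | inj₂ ch = ch

  z₀≢w₁ : z₀ ≢ w₁
  z₀≢w₁ e = case subst (3 ≤_) (trans (cong (deg G) e) E₁.deg-w) E₀.deg-z of λ { (s≤s (s≤s ())) }

  -- child-bound may omit ρ, w₁ and a third quasi-pendant vertex whose parent never needs a prescribed value.
  third : ∃ λ x → Quasi x × x ≢ ρ × x ≢ w₁ × (∀ i → Inner i → Inner (par i) → par x ≢ i)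
  third with E₀.z-class
  ... | inj₁ hq = z₀ , hq , proj₁ z₀-child , z₀≢w₁ ,
        λ i hi _ e → inner-¬quasi hi (subst Quasi (trans (sym (proj₂ z₀-child)) e) ρ-quasi)
  ... | inj₂ (hi , y , ych , y≢ρ , hy) = pick (y ≟ w₁)
    where
    -- A child of `z₀` could only serve `z₀` itself, whose parent is the quasi-pendant root; so `z₀`
    -- never asks for a prescribed value.
    below-z₀ : ∀ {x} → Child z₀ x → ∀ i → Inner i → Inner (par i) → par x ≢ i
    below-z₀ (_ , px) i _ hpi e = inner-¬quasi hpi (subst Quasi (trans (sym (proj₂ z₀-child)) (cong par (trans (sym px) e))) ρ-quasi)
    y-child : Child z₀ y
    y-child = nbr-child (T₀.child-adj ych) λ e → y≢ρ (trans e (proj₂ z₀-child))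
    pick : Dec (y ≡ w₁) → ∃ λ x → Quasi x × x ≢ ρ × x ≢ w₁ × (∀ i → Inner i → Inner (par i) → par x ≢ i)
    pick (no ne) = y , hy , y≢ρ , ne , below-z₀ y-child
    -- Here `z₁` is `z₀`, which is inner, so the end below the new root supplies a second
    -- quasi-pendant child.
    pick (yes e) with E₁.z-class
    ... | inj₁ hq = ⊥-elim (inner-¬quasi hi (subst Quasi (trans (sym E₁.par-w) (trans (cong par (sym e)) (proj₂ y-child))) hq))
    ... | inj₂ (_ , y′ , y′ch , y′≢w₁ , hy′) = y′ , hy′ , proj₁ y′ch , y′≢w₁ ,
          below-z₀ (proj₁ y′ch , trans (proj₂ y′ch) (trans (sym E₁.par-w) (trans (cong par (sym e)) (proj₂ y-child))))

  -- This is why `w₁` can be omitted: its parent is `z₁`, and if that is inner, `z-class` gives it a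
  -- further quasi-pendant child.
  another-child : ∀ i → Inner i → (∀ c → Child i c → Quasi c) → ∃ λ c → Child i c × Quasi c × c ≢ w₁
  another-child i hi children with has-child (inner-¬pendant hi)
  ... | c , ch with c ≟ w₁
  ...   | no ne = c , ch , children c ch , ne
  ...   | yes refl with E₁.z-class
  ...     | inj₁ hq = ⊥-elim (inner-¬quasi hi (subst Quasi (trans (sym E₁.par-w) (proj₂ ch)) hq))
  ...     | inj₂ (_ , y , ych , y≢w₁ , hy) = y , (proj₁ ych , trans (proj₂ ych) (trans (sym E₁.par-w) (proj₂ ch))) , hy , y≢w₁

  multiplicity-quasi-bound : ∀ r → MultAtLeast G 1ℚ r → 3 + r ≤ q G
  multiplicity-quasi-bound r mult with third
  ... | x , hx , x≢ρ , x≢w₁ , apart = ℕₚ.≤-trans (s≤s (s≤s (s≤s (child-bound ρ-quasi f₃ enough r mult)))) (ℕₚ.≤-reflexive (sym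
      (trans (countF-without quasi ρ ρ-quasi) (cong suc
        (trans (countF-without f₁ w₁ (without-intro quasi E₁.w-quasi E₁.w≢ρ)) (cong suc
          (countF-without f₂ x (without-intro f₁ (without-intro quasi hx x≢ρ) x≢w₁))))))))
    where
    quasi f₁ f₂ f₃ : Fin n → Bool
    quasi = isQuasiPendant G
    f₁ = without quasi ρ
    f₂ = without f₁ w₁
    f₃ = without f₂ x
    enough : ∀ i → Inner i → Inner (par i) → (∀ c → Child i c → Quasi c) → ∃ λ c → Child i c × f₃ c ≡ true
    enough i hi hpi children with another-child i hi children
    -- The child survives all three omissions: it is not the root because it has a parent, not `w₁`
    -- by choice, and not `x` because of `apart`.
    ... | c , ch , hc , c≢w₁ = c , ch ,
          without-intro f₂ (without-intro f₁ (without-intro quasi hc (proj₁ ch)) c≢w₁) λ { refl → apart i hi hpi (proj₂ ch) }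

  col : Fin n → Bool
  col x = even (depth x)

  col-proper : ∀ {u v} → adj G u v ≡ true → col v ≡ not (col u)
  col-proper {u} {v} uv with nbr-cases uv
  ... | inj₁ (ne , refl) = trans (sym (Boolₚ.not-involutive _)) (cong not (sym (cong even (depth-par ne))))
  ... | inj₂ (ne , refl) = cong even (depth-par ne)

  col-proper′ : ∀ {u v} → adj G u v ≡ true → not (col v) ≡ not (not (col u))
  col-proper′ uv = cong not (col-proper uv)

  module C₁ = Coloured col col-proper
  module C₂ = Coloured (λ x → not (col x)) col-proper′

  inner-count : countF inner ≡ countF C₁.innerCol + countF C₂.innerCol
  inner-count = countF-split inner col

  order-count : n ≡ q G + (q G + (countF C₁.innerCol + countF C₂.innerCol))
  order-count = trans order-by-class (trans (ℕₚ.+-assoc (q G) (q G) _) (cong (λ m → q G + (q G + m)) inner-count))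

  -- The summands bound the two copies of `q G` and the two colour classes in `order-count`; 6 is
  -- twice the surplus 3.
  four-parts : ∀ r → 4 * r + 6 ≡ (3 + r) + ((3 + r) + (r + r))
  four-parts = solve-∀

  multiplicity-order-bound : ∀ r → MultAtLeast G 1ℚ r → 4 * r + 6 ≤ n
  multiplicity-order-bound r mult = ℕₚ.≤-trans (ℕₚ.≤-reflexive (four-parts r)) (ℕₚ.≤-trans
    (ℕₚ.+-mono-≤ hq (ℕₚ.+-mono-≤ hq (ℕₚ.+-mono-≤ (C₁.colour-bound r mult) (C₂.colour-bound r mult))))
    (ℕₚ.≤-reflexive (sym order-count)))
    where
    hq = multiplicity-quasi-bound r mult

  module Equality (r : ℕ) (order : 4 * r + 6 ≡ n) (mult : MultAtLeast G 1ℚ r) where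

    total : q G + (q G + (countF C₁.innerCol + countF C₂.innerCol)) ≤ (3 + r) + ((3 + r) + (r + r))
    total = ℕₚ.≤-reflexive (trans (sym order-count) (trans (sym order) (four-parts r)))

    hq : 3 + r ≤ q G
    hq = multiplicity-quasi-bound r mult

    total-inner : countF C₁.innerCol + countF C₂.innerCol ≤ r + r
    total-inner = sum-squeezeʳ hq (sum-squeezeʳ hq total)

    quasi-tight : q G ≤ 3 + r
    quasi-tight = sum-squeezeˡ (ℕₚ.+-mono-≤ hq (ℕₚ.+-mono-≤ (C₁.colour-bound r mult) (C₂.colour-bound r mult))) total

    module T₁ = C₁.Tight r mult (sum-squeezeˡ (C₂.colour-bound r mult) total-inner)
    module T₂ = C₂.Tight r mult (sum-squeezeʳ (C₁.colour-bound r mult) total-inner)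

    by-colour : ∀ {A : Set} x → (col x ≡ true → A) → (not (col x) ≡ true → A) → A
    by-colour x a b with col x
    ... | true = a refl
    ... | false = b refl

    mate : ∀ {x} → Inner x → ∃ λ y → adj G x y ≡ true × Inner y
    mate {x} hx = by-colour x (T₁.inner-has-inner-nbr hx) (T₂.inner-has-inner-nbr hx)

    mate-unique : ∀ {x y j} → Inner x → Inner y → Inner j → adj G x j ≡ true → adj G x y ≡ true → j ≡ y
    mate-unique {x} {y} hx hy hj xj xy =
      by-colour y (λ c → T₁.no-common-inner-nbr hj hy hx c xj xy) (λ c → T₂.no-common-inner-nbr hj hy hx c xj xy)

    inner-deg : ∀ {x} → Inner x → deg G x ≡ 2
    inner-deg {x} hx = by-colour x
      (λ c → T₁.inner-pair-degrees {x} {y} hx hy c xy only-y only-x)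
      (λ c → T₂.inner-pair-degrees {x} {y} hx hy c xy only-y only-x)
      where
      y = proj₁ (mate hx)
      xy = proj₁ (proj₂ (mate hx))
      hy = proj₂ (proj₂ (mate hx))
      only-y : ∀ j → adj G x j ≡ true → Inner j → j ≡ y
      only-y j xj hj = mate-unique {x} {y} {j} hx hy hj xj xy
      only-x : ∀ j → adj G y j ≡ true → Inner j → j ≡ x
      only-x j yj hj = mate-unique {y} {x} {j} hy hx hj yj (sym-adj xy)

    large-degree-quasi : ∀ {x} → 3 ≤ deg G x → Quasi x
    large-degree-quasi {x} h with quasi-or-inner {x} (λ hp → case subst (3 ≤_) (pendant-deg hp) h of λ { (s≤s ()) })
    ... | inj₁ hq = hq
    ... | inj₂ hi = case subst (3 ≤_) (inner-deg hi) h of λ { (s≤s (s≤s ())) }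

    z₀-quasi : Quasi z₀
    z₀-quasi = large-degree-quasi E₀.deg-z

    z₁-quasi : Quasi z₁
    z₁-quasi = large-degree-quasi E₁.deg-z

    -- A third edge between quasi-pendant vertices would improve the bound 3 + r ≤ q by one.
    quasi-edge : ∀ x → Quasi x → x ≢ ρ → Quasi (par x) → x ≡ z₀ ⊎ x ≡ w₁
    quasi-edge x hx x≢ρ hpx with x ≟ z₀ | x ≟ w₁
    ... | yes e | _ = inj₁ e
    ... | no _ | yes e = inj₂ e
    ... | no x≢z₀ | no x≢w₁ = ⊥-elim (ℕₚ.1+n≰n (ℕₚ.≤-trans (ℕₚ.≤-trans
        (s≤s (s≤s (s≤s (s≤s (child-bound ρ-quasi f₄ enough r mult))))) (ℕₚ.≤-reflexive (sym count))) quasi-tight))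
      where
      quasi f₁ f₂ f₃ f₄ : Fin n → Bool
      quasi = isQuasiPendant G
      f₁ = without quasi ρ
      f₂ = without f₁ w₁
      f₃ = without f₂ z₀
      f₄ = without f₃ x
      count : q G ≡ 4 + countF f₄
      count = trans (countF-without quasi ρ ρ-quasi) (cong suc
        (trans (countF-without f₁ w₁ (without-intro quasi E₁.w-quasi E₁.w≢ρ)) (cong suc
          (trans (countF-without f₂ z₀ (without-intro f₁ (without-intro quasi z₀-quasi (proj₁ z₀-child)) z₀≢w₁)) (cong suc
            (countF-without f₃ x (without-intro f₂ (without-intro f₁ (without-intro quasi hx x≢ρ) x≢w₁) x≢z₀)))))))
      -- The omitted vertices other than the root all have a quasi-pendant parent, so none of them
      -- is a child of an inner vertex.
      below : ∀ {i c y} → Inner i → Child i c → Quasi (par y) → c ≢ y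
      below hi (_ , refl) hpy refl = inner-¬quasi hi hpy
      enough : ∀ i → Inner i → Inner (par i) → (∀ c → Child i c → Quasi c) → ∃ λ c → Child i c × f₄ c ≡ true
      enough i hi _ children with has-child (inner-¬pendant hi)
      ... | c , ch = c , ch , without-intro f₃ (without-intro f₂ (without-intro f₁ (without-intro quasi (children c ch) (proj₁ ch))
        (below hi ch (subst Quasi (sym E₁.par-w) z₁-quasi)))
        (below hi ch (subst Quasi (sym (proj₂ z₀-child)) ρ-quasi)))
        (below hi ch hpx)

  -- The shape of an extremal tree

  module Spine (z₀-quasi : Quasi z₀) (z₁-quasi : Quasi z₁)
    (inner-deg : ∀ {x} → Inner x → deg G x ≡ 2)
    (mate : ∀ {x} → Inner x → ∃ λ y → adj G x y ≡ true × Inner y)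
    (mate-unique : ∀ {x y j} → Inner x → Inner y → Inner j → adj G x j ≡ true → adj G x y ≡ true → j ≡ y)
    (quasi-edge : ∀ x → Quasi x → x ≢ ρ → Quasi (par x) → x ≡ z₀ ⊎ x ≡ w₁) where

    D : ℕ
    D = depth w₁

    ancestor : ℕ → Fin n
    ancestor zero = w₁
    ancestor (suc m) = par (ancestor m)

    -- The path from the root to `w₁`, numbered from the root so that indices agree with depths up
    -- to `D`; beyond `D` it stays at `w₁`.
    t : ℕ → Fin n
    t j = ancestor (D ∸ j)

    par-t : ∀ {j} → j < D → par (t (suc j)) ≡ t j
    par-t {j} j<D = cong ancestor (sym (ℕₚ.+-∸-assoc 1 {D} {suc j} j<D))

    depth≢0 : ∀ {x m} → depth x ≡ suc m → x ≢ ρ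
    depth≢0 h e = case trans (sym h) (trans (cong depth e) depth-root) of λ ()

    depth-ancestor : ∀ m → m ≤ D → depth (ancestor m) ≡ D ∸ m
    depth-ancestor zero _ = refl
    depth-ancestor (suc m) m<D = ℕₚ.suc-injective (trans (sym (depth-par (depth≢0 h))) h)
      where
      h : depth (ancestor m) ≡ suc (D ∸ suc m)
      h = trans (depth-ancestor m (ℕₚ.<⇒≤ m<D)) (ℕₚ.+-∸-assoc 1 {D} {suc m} m<D)

    depth-t : ∀ {j} → j ≤ D → depth (t j) ≡ j
    depth-t {j} j≤D = trans (depth-ancestor (D ∸ j) (ℕₚ.m∸n≤m D j)) (ℕₚ.m∸[m∸n]≡n j≤D)

    t-injective : ∀ {i j} → i ≤ D → j ≤ D → t i ≡ t j → i ≡ j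
    t-injective hi hj e = trans (sym (depth-t hi)) (trans (cong depth e) (depth-t hj))

    pendant-childless : ∀ {x c} → Child x c → x ≢ ρ → ¬ Pendant x
    pendant-childless ch x≢ρ = two-nbrs⇒¬pendant (child-adj ch) (par-adj x≢ρ)
      λ e → ℕₚ.m≢1+n+m (depth (par _)) {1} (trans (cong depth (sym e)) (trans (child-depth ch) (cong suc (depth-par x≢ρ))))

    t-child : ∀ {j} → j < D → Child (t j) (t (suc j))
    t-child {j} j<D = depth≢0 (depth-t j<D) , par-t j<D

    t-nonpendant : ∀ {j} → j ≤ D → ¬ Pendant (t j)
    t-nonpendant {j} j≤D hp with j ℕ.≟ D
    ... | yes refl = pendant-¬quasi (subst Pendant (cong ancestor (ℕₚ.n∸n≡0 D)) hp) E₁.w-quasi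
    ... | no ne with t j ≟ ρ
    ...   | yes e = pendant-¬quasi (subst Pendant e hp) ρ-quasi
    ...   | no t≢ρ = pendant-childless (t-child (ℕₚ.≤∧≢⇒< j≤D ne)) t≢ρ hp

    -- A vertex with a non-pendant child inherits the claim from that child. Otherwise it has one
    -- pendant child and degree 2, and `noP₃` makes its parent quasi-pendant; by `quasi-edge` it is
    -- `z₀` or `w₁`, and the degree of `z₀` is too large.
    spine : ∀ x → ¬ Pendant x → depth x ≤ D × x ≡ t (depth x)
    spine = depth-induction (λ x → ¬ Pendant x → depth x ≤ D × x ≡ t (depth x)) at
      where
      at : ∀ x → (∀ y → depth x < depth y → ¬ Pendant y → depth y ≤ D × y ≡ t (depth y)) →
        ¬ Pendant x → depth x ≤ D × x ≡ t (depth x)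
      at x rec hx with any? (λ c → ¬? (c ≟ ρ) ×-dec (par c ≟ x) ×-dec ¬? (pendant? c))
      ... | yes (c , c≢ρ , pc , hc) with rec c (ℕₚ.≤-reflexive (sym (child-depth (c≢ρ , pc)))) hc
      ...   | dc≤D , ec = ℕₚ.<⇒≤ x<D , trans (sym pc) (trans (cong par (trans ec (cong t dc))) (par-t x<D))
        where
        dc : depth c ≡ suc (depth x)
        dc = child-depth (c≢ρ , pc)
        x<D : depth x < D
        x<D = subst (_≤ D) dc dc≤D
      at x rec hx | no none = subst (λ y → depth y ≤ D × y ≡ t (depth y)) (sym x≡w₁)
          (ℕₚ.≤-refl , cong ancestor (sym (ℕₚ.n∸n≡0 D)))
        where
        pendant-child : ∀ {c} → Child x c → Pendant c
        pendant-child {c} (c≢ρ , pc) with pendant? c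
        ... | yes h = h
        ... | no h = ⊥-elim (none (c , c≢ρ , pc , h))
        x≢ρ : x ≢ ρ
        x≢ρ e = pendant-¬quasi (pendant-child (proj₁ z₀-child , trans (proj₂ z₀-child) (sym e))) z₀-quasi
        c = proj₁ (has-child hx)
        ch : Child x c
        ch = proj₂ (has-child hx)
        x-quasi : Quasi x
        x-quasi = quasi-intro (child-adj ch) (pendant-child ch)
        c≢px : c ≢ par x
        c≢px e = ℕₚ.m≢1+n+m (depth (par x)) {1} (trans (cong depth (sym e)) (trans (child-depth ch) (cong suc (depth-par x≢ρ))))
        deg-x : deg G x ≡ 2
        deg-x with 3 ℕ.≤? deg G x
        ... | no h = ℕₚ.≤-antisym (ℕ.s≤s⁻¹ (ℕₚ.≰⇒> h)) (¬pendant⇒2≤deg hx)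
        ... | yes h with countF-third (adj G x) h c (par x)
        ...   | y , xy , y≢c , y≢px = ⊥-elim (y≢c (pendant-unique xy (child-adj ch) (pendant-child (nbr-child xy y≢px)) (pendant-child ch)))
        px-quasi : Quasi (par x)
        px-quasi with quasi-or-inner {par x} (λ h → c≢px (pendant-unique (child-adj ch) (par-adj x≢ρ) (pendant-child ch) h))
        ... | inj₁ h = h
        -- An inner parent has degree 2, so it would start a pendant path through `x` to `c`; `x`
        -- again fills the attaching position.
        ... | inj₂ h = ⊥-elim (noP₃ (par x , x , c , x , par-adj x≢ρ , sym-adj (par-adj x≢ρ) , child-adj ch ,
                inner-deg h , deg-x , pendant-deg (pendant-child ch)))
        x≡w₁ : x ≡ w₁
        x≡w₁ with quasi-edge x x-quasi x≢ρ px-quasi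
        ... | inj₂ e = e
        ... | inj₁ e = case subst (3 ≤_) (trans (cong (deg G) (sym e)) deg-x) E₀.deg-z of λ { (s≤s (s≤s ())) }

    spine-at : ∀ {x j} → ¬ Pendant x → depth x ≡ j → x ≡ t j
    spine-at hx dx = trans (proj₂ (spine _ hx)) (cong t dx)

    t-root : t 0 ≡ ρ
    t-root = depth-zero (depth-t z≤n)

    t-last : t D ≡ w₁
    t-last = cong ancestor (ℕₚ.n∸n≡0 D)

    depth-z₀ : depth z₀ ≡ 1
    depth-z₀ = trans (child-depth z₀-child) (cong suc depth-root)

    z₀-nonpendant : ¬ Pendant z₀
    z₀-nonpendant h = pendant-¬quasi h z₀-quasi

    t-one : t 1 ≡ z₀
    t-one = sym (spine-at z₀-nonpendant depth-z₀)

    1<D : 1 < D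
    1<D = ℕₚ.≤∧≢⇒< (subst (_≤ D) depth-z₀ (proj₁ (spine z₀ z₀-nonpendant)))
      λ e → z₀≢w₁ (trans (sym t-one) (trans (cong t e) t-last))

    -- One period of the spine: after a quasi-pendant vertex below the root come two inner vertices
    -- and a quasi-pendant one, and the path cannot stop in between.
    module Step {j : ℕ} (1≤j : 1 ≤ j) (hj : Quasi (t j)) (j+1<D : suc j < D) where

      a-inner : Inner (t (suc j))
      a-inner with quasi-or-inner (t-nonpendant (ℕₚ.<⇒≤ j+1<D))
      ... | inj₂ h = h
      ... | inj₁ h with quasi-edge _ h (proj₁ (t-child (ℕₚ.<⇒≤ j+1<D))) (subst Quasi (sym (par-t (ℕₚ.<⇒≤ j+1<D))) hj)
      -- The two exceptional edges end at depths 1 and `D`, and `suc j` lies strictly between.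
      ...   | inj₁ e = ⊥-elim (ℕₚ.<⇒≢ 1≤j (sym (ℕₚ.suc-injective (t-injective (ℕₚ.<⇒≤ j+1<D) (ℕₚ.<⇒≤ 1<D) (trans e (sym t-one))))))
      ...   | inj₂ e = ⊥-elim (ℕₚ.<⇒≢ j+1<D (t-injective (ℕₚ.<⇒≤ j+1<D) ℕₚ.≤-refl (trans e (sym t-last))))

      b-inner : Inner (t (suc (suc j)))
      b-inner with mate a-inner
      ... | y , ay , hy = subst Inner (spine-at (inner-¬pendant hy) (trans (child-depth ych) (cong suc (depth-t (ℕₚ.<⇒≤ j+1<D))))) hy
        where
        ych : Child (t (suc j)) y
        ych = nbr-child ay λ e → inner-¬quasi hy (subst Quasi (sym (trans e (par-t (ℕₚ.<⇒≤ j+1<D)))) hj)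

      j+2<D : suc (suc j) < D
      j+2<D = ℕₚ.≤∧≢⇒< j+1<D λ e → inner-¬quasi b-inner (subst Quasi (sym (trans (cong t e) t-last)) E₁.w-quasi)

      -- A third consecutive inner vertex would give the middle one two inner neighbours, against
      -- `mate-unique`.
      c-quasi : Quasi (t (suc (suc (suc j))))
      c-quasi with quasi-or-inner (t-nonpendant j+2<D)
      ... | inj₁ h = h
      ... | inj₂ h = ⊥-elim (ℕₚ.m≢1+n+m (suc j) {1} (t-injective (ℕₚ.<⇒≤ j+1<D) j+2<D
              (mate-unique b-inner h a-inner (sym-adj (child-adj (t-child j+1<D))) (child-adj (t-child j+2<D)))))

      -- If the path ended here, the parent `z₁` of `w₁` would be the second inner vertex, but `z₁`
      -- is quasi-pendant.
      j+3<D : suc (suc (suc j)) < D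
      j+3<D = ℕₚ.≤∧≢⇒< j+2<D λ e → inner-¬quasi b-inner (subst Quasi
        (trans (sym E₁.par-w) (trans (cong par (sym (trans (cong t e) t-last))) (par-t j+2<D))) z₁-quasi)

    -- The pattern from the vertex at depth `suc (c * 3)` down to the end. The number `k` is found
    -- where the path stops, and the ranges are then enlarged back towards `c = 0`.
    Claim : ℕ → Set
    Claim c = ∃ λ k → D ≡ suc (suc (k * 3)) × (∀ i → c ≤ i → i ≤ k → Quasi (t (suc (i * 3)))) ×
      (∀ i → c ≤ i → i < k → Inner (t (suc (suc (i * 3)))) × Inner (t (suc (suc (suc (i * 3))))))

    extend : ∀ {c} → Quasi (t (suc (c * 3))) →
      Inner (t (suc (suc (c * 3)))) × Inner (t (suc (suc (suc (c * 3))))) → Claim (suc c) → Claim c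
    extend {c} hc hab (k , D≡ , hQ , hI) = k , D≡ , hQ′ , hI′
      where
      hQ′ : ∀ i → c ≤ i → i ≤ k → Quasi (t (suc (i * 3)))
      hQ′ i c≤i i≤k with c ℕ.≟ i
      ... | yes refl = hc
      ... | no c≢i = hQ i (ℕₚ.≤∧≢⇒< c≤i c≢i) i≤k
      hI′ : ∀ i → c ≤ i → i < k → Inner (t (suc (suc (i * 3)))) × Inner (t (suc (suc (suc (i * 3)))))
      hI′ i c≤i i<k with c ℕ.≟ i
      ... | yes refl = hab
      ... | no c≢i = hI i (ℕₚ.≤∧≢⇒< c≤i c≢i) i<k

    -- `fuel` bounds the depth still to go: each period spends one unit and gains three levels.
    climb : ∀ fuel c → D ≤ fuel + suc (c * 3) → suc (c * 3) < D → Quasi (t (suc (c * 3))) → Claim c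
    climb zero c D≤ c<D _ = ⊥-elim (ℕₚ.<⇒≱ c<D D≤)
    climb (suc fuel) c D≤ c<D hc with suc (suc (c * 3)) ℕ.≟ D
    ... | yes e = c , sym e , (λ i c≤i i≤c → subst (λ i → Quasi (t (suc (i * 3)))) (ℕₚ.≤-antisym c≤i i≤c) hc) ,
          λ i c≤i i<c → ⊥-elim (ℕₚ.<⇒≱ i<c c≤i)
    ... | no ne = extend {c} hc (S.a-inner , S.b-inner) (climb fuel (suc c) (ℕₚ.≤-trans D≤ more) S.j+3<D S.c-quasi)
      where
      module S = Step {suc (c * 3)} (s≤s z≤n) hc (ℕₚ.≤∧≢⇒< c<D ne)
      more : suc fuel + suc (c * 3) ≤ fuel + suc (suc c * 3)
      more = ℕₚ.≤-trans (ℕₚ.≤-reflexive (sym (ℕₚ.+-suc fuel (suc (c * 3))))) (ℕₚ.+-monoʳ-≤ fuel (s≤s (s≤s (ℕₚ.m≤n+m (c * 3) 2))))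

    spine-classes : Claim 0
    spine-classes = climb D 0 (ℕₚ.m≤m+n D 1) 1<D (subst Quasi (sym t-one) z₀-quasi)

    module Layout (k : ℕ) (D≡ : D ≡ suc (suc (k * 3)))
      (c-quasi : ∀ i → i ≤ k → Quasi (t (suc (i * 3))))
      (ab-inner : ∀ i → i < k → Inner (t (suc (suc (i * 3)))) × Inner (t (suc (suc (suc (i * 3)))))) where

      open Places k

      vertexAt : Bool → ℕ → Fin n
      vertexAt false j = t j
      vertexAt true j = pen (t j)

      vertexOf : Code k → Fin n
      vertexOf c = vertexAt (pendantCode c) (place c)

      place≤D : ∀ c → place c ≤ D
      place≤D c = subst (place c ≤_) (sym D≡) (place≤ c)

      at-end : t (suc (suc (k * 3))) ≡ w₁
      at-end = trans (cong t (sym D≡)) t-last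

      pendant-site : ∀ c → pendantCode c ≡ true → Quasi (t (place c))
      pendant-site (P i) _ = c-quasi (toℕ i) (ℕ.s≤s⁻¹ (toℕ<n i))
      pendant-site X₂ _ = subst Quasi (sym t-root) ρ-quasi
      pendant-site Y₂ _ = subst Quasi (sym at-end) E₁.w-quasi

      vertex-injective : ∀ c d → vertexOf c ≡ vertexOf d → c ≡ d
      vertex-injective c d e with pendantCode c in pc | pendantCode d in pd
      ... | false | false = place-injective c d (trans pc (sym pd)) (t-injective (place≤D c) (place≤D d) e)
      ... | false | true = ⊥-elim (t-nonpendant (place≤D c) (subst Pendant (sym e) (pen-pendant (pendant-site d pd))))
      ... | true | false = ⊥-elim (t-nonpendant (place≤D d) (subst Pendant e (pen-pendant (pendant-site c pc))))
      ... | true | true = place-injective c d (trans pc (sym pd)) (t-injective (place≤D c) (place≤D d)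
              (pendant-nbr-unique (pen-pendant hc) (sym-adj (pen-adj hc))
                (subst (λ x → adj G x (t (place d)) ≡ true) (sym e) (sym-adj (pen-adj (pendant-site d pd))))))
        where hc = pendant-site c pc

      spine-code : ∀ x → ¬ Pendant x → ∃ λ c → pendantCode c ≡ false × t (place c) ≡ x
      spine-code x hx = proj₁ found , proj₁ (proj₂ found) , trans (cong t (proj₂ (proj₂ found))) (sym (proj₂ (spine x hx)))
        where found = place-surjective (depth x) (subst (depth x ≤_) D≡ (proj₁ (spine x hx)))

      pendant-code : ∀ c → pendantCode c ≡ false → Quasi (t (place c)) →
        ∃ λ d → pendantCode d ≡ true × place d ≡ place c
      pendant-code (C i) _ _ = P i , refl , refl
      pendant-code (A i) _ h = ⊥-elim (inner-¬quasi (proj₁ (ab-inner (toℕ i) (toℕ<n i))) h)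
      pendant-code (B i) _ h = ⊥-elim (inner-¬quasi (proj₂ (ab-inner (toℕ i) (toℕ<n i))) h)
      pendant-code X₁ _ _ = X₂ , refl , refl
      pendant-code Y₁ _ _ = Y₂ , refl , refl
      pendant-code Y₂ () _

      vertexOf-spine : ∀ c {x} → pendantCode c ≡ false → t (place c) ≡ x → vertexOf c ≡ x
      vertexOf-spine c e e′ = trans (cong (λ b → vertexAt b (place c)) e) e′

      vertexOf-pendant : ∀ c {j} → pendantCode c ≡ true → place c ≡ j → vertexOf c ≡ pen (t j)
      vertexOf-pendant c refl′ refl = cong (λ b → vertexAt b (place c)) refl′

      vertex-surjective : ∀ x → ∃ λ c → vertexOf c ≡ x
      vertex-surjective x = by-class (pendant? x)
        where
        by-class : Dec (Pendant x) → ∃ λ c → vertexOf c ≡ x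
        by-class (no hx) = let c , e , e′ = spine-code x hx in c , vertexOf-spine c e e′
        by-class (yes hx) = proj₁ found , trans (vertexOf-pendant (proj₁ found) (proj₁ (proj₂ found)) (proj₂ (proj₂ found)))
            (pendant-unique (pen-adj site) (subst (λ y → adj G y x ≡ true) (sym at-w) (sym-adj xw)) (pen-pendant site) hx)
          where
          w = proj₁ (some-nbr x)
          xw = proj₂ (some-nbr x)
          w-quasi : Quasi w
          w-quasi = quasi-intro (sym-adj xw) hx
          c = spine-code w λ h → pendant-¬quasi h w-quasi
          at-w : t (place (proj₁ c)) ≡ w
          at-w = proj₂ (proj₂ c)
          site : Quasi (t (place (proj₁ c)))
          site = subst Quasi (sym at-w) w-quasi
          found = pendant-code (proj₁ c) (proj₁ (proj₂ c)) site

      t-adj : ∀ {j} → j < D → adj G (t j) (t (suc j)) ≡ true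
      t-adj j<D = child-adj (t-child j<D)

      edge⇒adj : ∀ {c d} → Edge c d → adj G (vertexOf c) (vertexOf d) ≡ true
      edge⇒adj (c-p i) = pen-adj (pendant-site (P i) refl)
      edge⇒adj (c-a i) rewrite toℕ-inject₁ i = t-adj (place≤D (A i))
      edge⇒adj (a-b i) = t-adj (place≤D (B i))
      edge⇒adj (c-b i) = sym-adj (t-adj (place≤D (C (fsuc i))))
      edge⇒adj c-x = sym-adj (t-adj (place≤D (C fzero)))
      edge⇒adj x-x = pen-adj (pendant-site X₂ refl)
      edge⇒adj c-y rewrite toℕ-fromℕ k = t-adj (place≤D Y₁)
      edge⇒adj y-y = pen-adj (pendant-site Y₂ refl)

      pen≢ρ : ∀ j → Quasi (t j) → pen (t j) ≢ ρ
      pen≢ρ j hj e = pendant-¬quasi (subst Pendant e (pen-pendant hj)) ρ-quasi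

      par-pen : ∀ j → Quasi (t j) → par (pen (t j)) ≡ t j
      par-pen j hj = pendant-nbr-unique (pen-pendant hj) (par-adj (pen≢ρ j hj)) (sym-adj (pen-adj hj))

      -- Every edge is a parent edge, so locating the parent of each vertex settles all adjacencies
      -- without a case analysis over pairs of codes.
      parent-code : ∀ d → vertexOf d ≢ ρ → ∃ λ c → Adjacent c d × par (vertexOf d) ≡ vertexOf c
      parent-code (C fzero) _ = X₁ , inj₂ c-x , par-t (place≤D (C fzero))
      parent-code (C (fsuc i)) _ = B i , inj₂ (c-b i) , par-t (place≤D (C (fsuc i)))
      parent-code (P i) _ = C i , inj₁ (c-p i) , par-pen (place (P i)) (pendant-site (P i) refl)
      parent-code (A i) _ = C (inject₁ i) , inj₁ (c-a i) ,
        trans (par-t (place≤D (A i))) (cong (λ m → t (suc (m * 3))) (sym (toℕ-inject₁ i)))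
      parent-code (B i) _ = A i , inj₁ (a-b i) , par-t (place≤D (B i))
      parent-code X₁ h = ⊥-elim (h t-root)
      parent-code X₂ _ = X₁ , inj₁ x-x , par-pen (place X₂) (pendant-site X₂ refl)
      parent-code Y₁ _ = C (fromℕ k) , inj₁ c-y ,
        trans (par-t (place≤D Y₁)) (cong (λ m → t (suc (m * 3))) (sym (toℕ-fromℕ k)))
      parent-code Y₂ _ = Y₁ , inj₁ y-y , par-pen (place Y₂) (pendant-site Y₂ refl)

      child⇒adjacent : ∀ c d → Child (vertexOf c) (vertexOf d) → Adjacent c d
      child⇒adjacent c d (d≢ρ , e) = let c′ , a , e′ = parent-code d d≢ρ in
        subst (λ c → Adjacent c d) (vertex-injective c′ c (trans (sym e′) e)) a

      adj⇒edge : ∀ c d → adj G (vertexOf c) (vertexOf d) ≡ true → Adjacent c d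
      adj⇒edge c d h = either (nbr-cases h)
        where
        either : Child (vertexOf d) (vertexOf c) ⊎ Child (vertexOf c) (vertexOf d) → Adjacent c d
        either (inj₁ ch) = case child⇒adjacent d c ch of λ { (inj₁ e) → inj₂ e ; (inj₂ e) → inj₁ e }
        either (inj₂ ch) = child⇒adjacent c d ch

      realisation : Realises G k
      realisation = record
        { vertex = vertexOf ; injective = λ {c} {d} → vertex-injective c d ; surjective = vertex-surjective
        ; adj⇒edge = λ {c} {d} → adj⇒edge c d ; edge⇒adj = edge⇒adj }

    extremal : ∃ λ k → Realises G k
    extremal = let k , D≡ , hQ , hI = spine-classes in
      k , Layout.realisation k D≡ (λ i → hQ i z≤n) (λ i → hI i z≤n)

  equality⇒realises : ∀ r → 4 * r + 6 ≡ n → MultAtLeast G 1ℚ r → ∃ λ k → Realises G k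
  equality⇒realises r order mult = Spine.extremal E.z₀-quasi E.z₁-quasi E.inner-deg E.mate E.mate-unique E.quasi-edge
    where module E = Equality r order mult

-- With the upper bound in the first component, a lower bound `MultAtLeast T 1ℚ r` at
-- `4 * r + 6 ≡ n` says that the multiplicity is exactly `r`.
theorem1p2 : (n : ℕ) (T : Graph n) → IsTree T → 6 ≤ n → p T ≡ q T → ¬ HasPendantP3 T →
    ((r : ℕ) → MultAtLeast T 1ℚ r → 4 * r + 6 ≤ n)
    × ((Σ ℕ λ r → (4 * r + 6 ≡ n) × MultAtLeast T 1ℚ r) ⇔ (Σ ℕ λ k → T ≅ Tk k))
theorem1p2 n T tree 6≤n p≡q noP₃ =
  Pruned.multiplicity-order-bound T tree 6≤n p≡q noP₃ (rooted-at ρ₀) (end-from ρ₀) (rooted-at ρ) (end-from ρ) ,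
  mk⇔ extremal⇒Tk Tk⇒extremal
  where
  rooted-at : (ρ : Fin n) → Rooted T ρ
  rooted-at = BFS.rooted T (proj₂ tree) (proj₁ tree)
  end-from : (ρ : Fin n) → RootedPendantTree.End T tree 6≤n p≡q (rooted-at ρ)
  end-from ρ = RootedPendantTree.end T tree 6≤n p≡q (rooted-at ρ) noP₃
  -- The root `ρ₀` is an arbitrary vertex and only serves to locate the end `ρ` at which the tree is
  -- rooted again.
  ρ₀ ρ : Fin n
  ρ₀ = fromℕ< (ℕₚ.≤-trans (s≤s z≤n) 6≤n)
  ρ = RootedPendantTree.End.w (end-from ρ₀)
  extremal⇒Tk : (Σ ℕ λ r → (4 * r + 6 ≡ n) × MultAtLeast T 1ℚ r) → Σ ℕ λ k → T ≅ Tk k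
  extremal⇒Tk (r , order , mult) =
    let k , real = Pruned.equality⇒realises T tree 6≤n p≡q noP₃ (rooted-at ρ₀) (end-from ρ₀) (rooted-at ρ) (end-from ρ) r order mult
    in k , realisations-isomorphic real (realises-Tk k)
  Tk⇒extremal : (Σ ℕ λ k → T ≅ Tk k) → Σ ℕ λ r → (4 * r + 6 ≡ n) × MultAtLeast T 1ℚ r
  Tk⇒extremal (k , iso) = k , sym (↔⇒≡ (proj₁ iso)) , Eigenvectors.multiplicity T (realises-isomorphic iso (realises-Tk k))
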